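{- For every integer $n\ge 1$, $$|\mathcal{S}_n(21;\,3\to 3)| = d_n + \sum_{m=1}^{n}\sum_{k=0}^{n-m}\binom{n-m}{k}\binom{m+k-1}{n-m}\, d_k,$$ where $d_j$ denotes the $j$-th derangement number.
   Context: $[n]=\{1,\dots,n\}$, and $\mathcal{S}_n$ is the set of permutations $\pi=\pi_1\pi_2\cdots\pi_n$ of $[n]$ in one-line notation. The permutation $\hat\pi$: for $\pi\in\mathcal{S}_n$, $\hat\pi\in\mathcal{S}_n$ is the permutation whose cycle form is obtained from the word $\pi_1\cdots\pi_n$ by inserting a left parenthesis before each left-to-right maximum (an entry larger than all entries to its left) and a right parenthesis immediately before the next left-to-right maximum, or at the end of the word. A cycle $(c_1,c_2,\dots,c_s)$ means $c_1\mapsto c_2\mapsto\cdots\mapsto c_s\mapsto c_1$. Example: if $\pi=2537164$ then $\hat\pi=(2)(53)(7164)$. Arrow patterns: an arrow pattern of size $k$ is a pair $(\nu;H)$ where $\nu=\nu_1\cdots\nu_m$ is a word of distinct positive integers, $H$ is a collection of arrows $b_i\to c_i$, and the set of all integers appearing in $\nu$ or $H$ is $[k]$. A permutation $\pi\in\mathcal{S}_n$ contains $(\nu;H)$ if there are a set $X=\{x_1<x_2<\cdots<x_k\}\subseteq[n]$ and indices $t_1<\cdots<t_m$ such that $\pi_{t_1}\pi_{t_2}\cdots\pi_{t_m}=x_{\nu_1}x_{\nu_2}\cdots x_{\nu_m}$ and $\hat\pi(x_{b_i})=x_{c_i}$ for every arrow $b_i\to c_i$ in $H$. Otherwise $\pi$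 avoids $(\nu;H)$. $\mathcal{S}_n(\nu;H)$ is the set of permutations in $\mathcal{S}_n$ avoiding $(\nu;H)$. The derangement number $d_j$ is the number of permutations of $[j]$ without fixed points ($d_0=1$, $d_1=0$). Binomial coefficients $\binom{a}{b}$ with $0\le a<b$ are $0$. -}

module Defs where

open import Data.Fin using (Fin; zero; suc; _<_)
open import Data.Fin.Patterns using (0F; 1F; 2F; 3F; 4F; 5F; 6F)
open import Data.Fin.Properties using (_≟_; _<?_; any?; all?)
open import Data.List using (List; []; _∷_; length; filter; map; applyUpTo; allFin; cartesianProductWith)
open import Data.List.Membership.DecPropositional using (_∈?_)
open import Data.List.Membership.Propositional using (_∈_)
open import Data.List.Membership.Propositional.Properties using (∈-cartesianProductWith⁺; ∈-allFin; ∈-filter⁺; ∈-filter⁻)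
open import Data.List.Relation.Unary.All as All using (All; []; _∷_)
open import Data.List.Relation.Unary.AllPairs using ([]; _∷_)
open import Data.List.Relation.Unary.Any using (Any; here; there)
import Data.List.Relation.Unary.Unique.Propositional as List
import Data.List.Relation.Unary.Unique.Propositional.Properties as Unique
open import Data.Nat as ℕ using (ℕ; zero; suc; _+_; _∸_)
open import Data.Nat.ListAction using (sum)
open import Data.Product using (∃-syntax; _×_; _,_; proj₁; proj₂)
open import Data.Sum using (_⊎_; inj₁; inj₂)
open import Data.Vec as Vec using (Vec; []; _∷_; lookup; toList)
open import Data.Vec.Properties using (≡-dec; ∷-injective)
open import Data.Vec.Relation.Unary.All using ([]; _∷_)
open import Data.Vec.Relation.Unary.AllPairs using (AllPairs; allPairs?; []; _∷_)
open import Data.Vec.Relation.Unary.Unique.Propositional using (Unique)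
open import Function using (_∘_; _⇔_; mk⇔)
open import Relation.Binary.PropositionalEquality using (_≡_; _≢_; refl)
open import Relation.Nullary using (Dec; yes; no; ¬_; ¬?)
open import Relation.Nullary.Decidable using (map′; _×-dec_)
open import Relation.Unary using (Decidable)

private
  variable
    k m n : ℕ

-- The letter i ∈ [n] is represented by the element of Fin n with toℕ equal
-- to i ∸ 1, so a permutation in one-line notation is a repetition-free word
-- of length n over Fin n.

words : ∀ n m → List (Vec (Fin n) m)
words n zero    = [] ∷ []
words n (suc m) = cartesianProductWith _∷_ (allFin n) (words n m)

unique? : Decidable (Unique {A = Fin n} {m})
unique? = allPairs? (λ i j → ¬? (i ≟ j))

permutations : ∀ n → List (Vec (Fin n) n)
permutations n = filter unique? (words n n)

-- `permutations n` lists every permutation of [n], each exactly once.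

∈-words : (w : Vec (Fin n) m) → w ∈ words n m
∈-words []      = here refl
∈-words (i ∷ w) = ∈-cartesianProductWith⁺ _∷_ (∈-allFin i) (∈-words w)

words-unique : ∀ n m → List.Unique (words n m)
words-unique n zero    = [] ∷ []
words-unique n (suc m) =
  Unique.cartesianProductWith⁺ _∷_ ∷-injective (Unique.allFin⁺ n) (words-unique n m)

∈-permutations : (π : Vec (Fin n) n) → π ∈ permutations n ⇔ Unique π
∈-permutations {n} π =
  mk⇔ (proj₂ ∘ ∈-filter⁻ unique? {xs = words n n}) (∈-filter⁺ unique? (∈-words π))

permutations-unique : ∀ n → List.Unique (permutations n)
permutations-unique n = Unique.filter⁺ unique? (words-unique n n)

countPermutations : ∀ {P : Vec (Fin n) n → Set} → Decidable P → ℕ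
countPermutations {n} P? = length (filter P? (permutations n))

-- `splitCycles left w` cuts w, the part of a word to the right of the (reversed)
-- prefix left, in front of each left-to-right maximum of the whole word.  It
-- returns the piece preceding the first cut, which completes the cycle
-- left open by the prefix, and the remaining pieces.

splitCycles : List (Fin n) → List (Fin n) → List (Fin n) × List (List (Fin n))
splitCycles left []      = [] , []
splitCycles left (x ∷ w) with All.all? (_<? x) left | splitCycles (x ∷ left) w
... | yes _ | c , cs = [] , (x ∷ c) ∷ cs
... | no  _ | c , cs = x ∷ c , cs

cycleForm : Vec (Fin n) n → List (List (Fin n))
cycleForm π = proj₂ (splitCycles [] (toList π))

_ : cycleForm (1F ∷ 4F ∷ 2F ∷ 6F ∷ 0F ∷ 5F ∷ 3F ∷ [])
    ≡ (1F ∷ []) ∷ (4F ∷ 2F ∷ []) ∷ (6F ∷ 0F ∷ 5F ∷ 3F ∷ []) ∷ []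
_ = refl

-- `next c a w x` is the letter following x in the word a w c.

next : Fin n → Fin n → List (Fin n) → Fin n → Fin n
next c a []      x = c
next c a (b ∷ w) x with a ≟ x
... | yes _ = b
... | no  _ = next c b w x

applyCycles : List (List (Fin n)) → Fin n → Fin n
applyCycles []             x = x
applyCycles ([] ∷ cs)      x = applyCycles cs x
applyCycles ((c ∷ w) ∷ cs) x with _∈?_ _≟_ x (c ∷ w)
... | yes _ = next c c w x
... | no  _ = applyCycles cs x

hat : Vec (Fin n) n → Fin n → Fin n
hat π = applyCycles (cycleForm π)

_ : Vec.tabulate (hat (1F ∷ 4F ∷ 2F ∷ 6F ∷ 0F ∷ 5F ∷ 3F ∷ []))
    ≡ 5F ∷ 1F ∷ 4F ∷ 6F ∷ 2F ∷ 3F ∷ 0F ∷ []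
_ = refl

-- The arrow b → c is the pair (b , c).

record ArrowPattern (k m : ℕ) : Set where
  field
    ν        : Vec (Fin k) m
    H        : List (Fin k × Fin k)
    distinct : Unique ν
    covering : ∀ i → i ∈ toList ν ⊎ Any (λ (b , c) → i ≡ b ⊎ i ≡ c) H

Increasing : Vec (Fin n) m → Set
Increasing = AllPairs _<_

Contains : ArrowPattern k m → Vec (Fin n) n → Set
Contains {k} {m} {n} p π =
  ∃[ x ] Increasing {n} {k} x ×
  ∃[ t ] Increasing {n} {m} t ×
    Vec.map (lookup π) t ≡ Vec.map (lookup x) ν ×
    All (λ (b , c) → hat π (lookup x b) ≡ lookup x c) H
  where open ArrowPattern p

Avoids : ArrowPattern k m → Vec (Fin n) n → Set
Avoids p π = ¬ Contains p π

anyVec? : {P : Vec (Fin n) m → Set} → Decidable P → Dec (∃[ v ] P v)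
anyVec? {m = zero}  P? = map′ ([] ,_) (λ { ([] , p) → p }) (P? [])
anyVec? {m = suc m} P? =
  map′ (λ (i , v , p) → i ∷ v , p) (λ { (i ∷ v , p) → i , v , p })
       (any? (λ i → anyVec? (λ v → P? (i ∷ v))))

contains? : (p : ArrowPattern k m) → Decidable (Contains {n = n} p)
contains? p π =
  anyVec? λ x → allPairs? _<?_ x ×-dec
  anyVec? λ t → allPairs? _<?_ t ×-dec
    ≡-dec _≟_ (Vec.map (lookup π) t) (Vec.map (lookup x) ν) ×-dec
    All.all? (λ (b , c) → hat π (lookup x b) ≟ lookup x c) H
  where open ArrowPattern p

avoids? : (p : ArrowPattern k m) → Decidable (Avoids {n = n} p)
avoids? p π = ¬? (contains? p π)

∣𝒮_[_]∣ : ∀ n → ArrowPattern k m → ℕ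
∣𝒮 n [ p ]∣ = countPermutations {n} (avoids? p)

⟨21⨾3→3⟩ : ArrowPattern 3 2
⟨21⨾3→3⟩ = record
  { ν        = 1F ∷ 0F ∷ []
  ; H        = (2F , 2F) ∷ []
  ; distinct = ((λ ()) ∷ []) ∷ [] ∷ []
  ; covering = λ { 0F → inj₁ (there (here refl))
                 ; 1F → inj₁ (here refl)
                 ; 2F → inj₂ (here (inj₁ refl)) }
  }

Derangement : Vec (Fin n) n → Set
Derangement π = ∀ i → lookup π i ≢ i

derangement? : Decidable (Derangement {n})
derangement? π = all? (λ i → ¬? (lookup π i ≟ i))

derangements : ℕ → ℕ
derangements j = countPermutations {j} derangement?

∑[_⋯_] : ℕ → ℕ → (ℕ → ℕ) → ℕ
∑[ a ⋯ b ] f = sum (map f (applyUpTo (a +_) (suc b ∸ a)))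

{-# OPTIONS --safe #-}

-- A permutation π avoids (21; 3→3) iff π̂ has no fixed point or the letters below
-- the largest fixed point m of π̂ increase.  A fixed point of π̂ is a
-- left-to-right maximum of π that is last or directly followed by another one,
-- so in the second case π is obtained from a permutation σ of the N = n − m
-- letters above m by shuffling 1 … m−1 into it, at least one of them directly
-- after each of the N − k fixed points of σ̂, and putting m before the first
-- letter of σ; this leaves (m + k − 1) C N choices.  Finally, inserting a new
-- least letter into a word changes the number of non-fixed points of π̂ exactly
-- as inserting a new point into a cycle changes that of π, so both statistics
-- are equidistributed and (N C k) d_k permutations σ have k non-fixed points.

module Submission where

open import Defs
open import Data.Bool using (Bool; true; false; _∧_; if_then_else_)
open import Data.Bool.Properties as Bool using (∧-zeroʳ; T-≡)
open import Data.Empty using (⊥; ⊥-elim)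
open import Data.Fin as Fin using (Fin; zero; suc; toℕ)
open import Data.Fin.Properties as Fin using (_≟_)
open import Data.List as List using (List; []; _∷_; _++_)
open import Data.List.Membership.DecPropositional using (_∈?_)
open import Data.List.Membership.Propositional using () renaming (_∈_ to _∈ₗ_; _∉_ to _∉ₗ_)
import Data.List.Membership.Propositional.Properties as List
import Data.List.Properties as List
open import Data.List.Relation.Binary.Permutation.Propositional as ↭ using (_↭_; prep; swap; ↭-sym; ↭⇒↭ₛ)
open import Data.List.Relation.Unary.All as ListAll using ([]; _∷_)
import Data.List.Relation.Unary.All.Properties as ListAll
open import Data.List.Relation.Unary.AllPairs using ([]; _∷_)
open import Data.List.Relation.Unary.Any using (here; there)
import Data.List.Relation.Unary.Unique.Propositional as List using (Unique)
open import Data.Nat using (ℕ; zero; suc; _+_; _*_; _∸_; _≤_; _<_; _⊔_; _≤ᵇ_; z≤n; s≤s)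
open import Data.Nat.Combinatorics using (_C_; nCn≡1; nC1≡n; k>n⇒nCk≡0; nCk+nC[k+1]≡[n+1]C[k+1])
open import Data.Nat.ListAction using () renaming (sum to sumₗ)
open import Data.Nat.ListAction.Properties using (sum-++)
open import Data.Nat.Properties as ℕ hiding (_≟_)
open import Data.Nat.Solver using (module +-*-Solver)
open import Data.Product using (∃-syntax; _×_; _,_; proj₁; proj₂)
open import Data.Sum using (_⊎_; inj₁; inj₂; [_,_]′)
open import Data.Vec as Vec using (Vec; []; _∷_; toList; lookup; insertAt; _[_]≔_)
open import Data.Vec.Membership.Propositional using (_∈_; _∉_)
open import Data.Vec.Membership.Propositional.Properties using (∈-toList⁺; ∈-lookup)
open import Data.Vec.Properties using (lookup-map; ∷-injective)
open import Data.Vec.Relation.Unary.All as All using (All; []; _∷_)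
import Data.Vec.Relation.Unary.All.Properties as All
open import Data.Vec.Relation.Unary.AllPairs using (AllPairs; allPairs?; []; _∷_)
open import Data.Vec.Relation.Unary.Any using (any?; here; there)
open import Data.Vec.Relation.Unary.Unique.Propositional using (Unique)
open import Data.Vec.Relation.Unary.Unique.Propositional.Properties using (lookup-injective; map⁺)
open import Function using (_∘_; _⇔_; mk⇔; Equivalence; case_of_)
open import Relation.Binary.Definitions using (tri<; tri≈; tri>)
open import Relation.Binary.PropositionalEquality
open import Relation.Nullary using (Dec; yes; no; ¬_; ¬?; does)
open import Relation.Nullary.Decidable using (_×-dec_; _⊎-dec_; _→-dec_)
open import Relation.Unary using (Decidable)

open import Algebra.Properties.CommutativeSemigroup *-commutativeSemigroup using (interchange)
open import Algebra.Properties.CommutativeSemigroup +-commutativeSemigroup using (x∙yz≈y∙xz)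
open import Algebra.Properties.Semiring.Sum +-*-semiring
  using (sum; sum-cong-≗; sum-replicate-zero; ∑-distrib-+; ∑-comm; *-distribˡ-sum)

open Equivalence using (to; from)

-- The binomial coefficient is stars and bars. The `m - 1` small letters go into `N + 1` gaps: one
-- before the block formed by `m` and the first letter of σ, and one after each letter of σ. Between
-- `m` and that first letter there is no gap, since `m` would stop being fixed. As `N - k` gaps must
-- be nonempty, `m - 1 - (N - k)` letters remain free, which gives `(m + k - 1) C N` ways; with too
-- few small letters the coefficient is 0. The obstacle is that shuffles of words over different
-- alphabets are awkward to build and take apart bijectively. Counts are therefore sums of
-- 0/1-valued functions over all words, one sum per position, and bijections are replaced by
-- splitting and exchanging these sums. This requires the condition on π to be read from left to
-- right with a small state, hence the automaton. Likewise equidistribution is reduced to a one-step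
-- recurrence, required for every test function `F`.

private
  variable
    m n L : ℕ
    P Q : Set

-- Indicator functions and sums over words

-- A relation rather than a function: it certifies that a number obtained as a product or sum, such
-- as the weight of an automaton, is the 0/1 value of `P`; `indicator-unique` turns two certificates
-- into an equation.
data Indicator (P : Set) : ℕ → Set where
  one  : P → Indicator P 1
  zero : ¬ P → Indicator P 0

ind : Dec P → ℕ
ind d = if does d then 1 else 0

ind-indicator : (d : Dec P) → Indicator P (ind d)
ind-indicator (yes p) = one p
ind-indicator (no ¬p) = zero ¬p

indicator-unique : ∀ {a b} → Indicator P a → Indicator P b → a ≡ b
indicator-unique (one _)   (one _)   = refl
indicator-unique (one p)   (zero ¬p) = ⊥-elim (¬p p)
indicator-unique (zero ¬p) (one p)   = ⊥-elim (¬p p)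
indicator-unique (zero _)  (zero _)  = refl

indicator-⇔ : ∀ {a} → P ⇔ Q → Indicator P a → Indicator Q a
indicator-⇔ e (one p)   = one (to e p)
indicator-⇔ e (zero ¬p) = zero (¬p ∘ from e)

indicator-× : ∀ {a b} → Indicator P a → Indicator Q b → Indicator (P × Q) (a * b)
indicator-× (one p)   (one q)   = one (p , q)
indicator-× (one _)   (zero ¬q) = zero (¬q ∘ proj₂)
indicator-× (zero ¬p) _         = zero (¬p ∘ proj₁)

indicator-⊎ : ∀ {a b} → ¬ (P × Q) → Indicator P a → Indicator Q b → Indicator (P ⊎ Q) (a + b)
indicator-⊎ ¬pq (one p)   (one q)   = ⊥-elim (¬pq (p , q))
indicator-⊎ ¬pq (one p)   (zero _)  = one (inj₁ p)
indicator-⊎ ¬pq (zero _)  (one q)   = one (inj₂ q)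
indicator-⊎ ¬pq (zero ¬p) (zero ¬q) = zero [ ¬p , ¬q ]′

indicator-∃ : {R : Fin n → Set} {a : Fin n → ℕ} → (∀ {i j} → R i → R j → i ≡ j) →
              (∀ i → Indicator (R i) (a i)) → Indicator (∃[ i ] R i) (sum a)
indicator-∃ {zero}  _   _ = zero λ ()
indicator-∃ {suc n} inj f = indicator-⇔
  (mk⇔ [ zero ,_ , (λ (i , r) → suc i , r) ]′
       (λ { (zero , r) → inj₁ r ; (suc i , r) → inj₂ (i , r) }))
  (indicator-⊎ (λ (r , i , r′) → Fin.0≢1+n (inj r r′)) (f zero)
    (indicator-∃ (λ r r′ → Fin.suc-injective (inj r r′)) (f ∘ suc)))

indicator-yes : ∀ {a} → Indicator P a → P → a ≡ 1
indicator-yes (one _)   p = refl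
indicator-yes (zero ¬p) p = ⊥-elim (¬p p)

indicator-no : ∀ {a} → Indicator P a → ¬ P → a ≡ 0
indicator-no (one p)  ¬p = ⊥-elim (¬p p)
indicator-no (zero _) ¬p = refl

ind-yes : (d : Dec P) → P → ind d ≡ 1
ind-yes d = indicator-yes (ind-indicator d)

ind-no : (d : Dec P) → ¬ P → ind d ≡ 0
ind-no d = indicator-no (ind-indicator d)

ind-cong : (d : Dec P) (e : Dec Q) → P ⇔ Q → ind d ≡ ind e
ind-cong d e p⇔q = indicator-unique (indicator-⇔ p⇔q (ind-indicator d)) (ind-indicator e)

indicator-*-cong : ∀ {a b c} → Indicator P a → (P → b ≡ c) → a * b ≡ a * c
indicator-*-cong (one p)  eq = cong (1 *_) (eq p)
indicator-*-cong (zero _) eq = refl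

sum-zero : {f : Fin n → ℕ} → (∀ i → f i ≡ 0) → sum f ≡ 0
sum-zero {n} eq = trans (sum-cong-≗ eq) (sum-replicate-zero n)

sum-single : {f : Fin n → ℕ} (i : Fin n) → (∀ j → j ≢ i → f j ≡ 0) → sum f ≡ f i
sum-single {f = f} zero    eq =
  trans (cong (f zero +_) (sum-zero λ j → eq (suc j) λ ())) (+-identityʳ _)
sum-single {f = f} (suc i) eq =
  cong₂ _+_ (eq zero λ ()) (sum-single i λ j j≢i → eq (suc j) (j≢i ∘ Fin.suc-injective))

sum-↑ : ∀ m (f : Fin (m + n) → ℕ) →
        sum f ≡ sum (λ i → f (i Fin.↑ˡ n)) + sum (λ j → f (m Fin.↑ʳ j))
sum-↑ zero    f = refl
sum-↑ (suc m) f =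
  trans (cong (f zero +_) (sum-↑ m (f ∘ suc))) (sym (+-assoc (f zero) _ _))

∑words : ∀ n L → (Vec (Fin n) L → ℕ) → ℕ
∑words n zero    F = F []
∑words n (suc L) F = sum λ i → ∑words n L λ w → F (i ∷ w)

∑words-cong : ∀ n L {F G : Vec (Fin n) L → ℕ} → (∀ w → F w ≡ G w) → ∑words n L F ≡ ∑words n L G
∑words-cong n zero    eq = eq []
∑words-cong n (suc L) eq = sum-cong-≗ λ i → ∑words-cong n L λ w → eq (i ∷ w)

∑words-+ : ∀ n L (F G : Vec (Fin n) L → ℕ) →
           ∑words n L (λ w → F w + G w) ≡ ∑words n L F + ∑words n L G
∑words-+ n zero    F G = refl
∑words-+ n (suc L) F G =
  trans (sum-cong-≗ λ i → ∑words-+ n L (F ∘ (i ∷_)) (G ∘ (i ∷_))) (∑-distrib-+ {n} _ _)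

∑words-*ˡ : ∀ n L c (F : Vec (Fin n) L → ℕ) → ∑words n L (λ w → c * F w) ≡ c * ∑words n L F
∑words-*ˡ n zero    c F = refl
∑words-*ˡ n (suc L) c F =
  trans (sum-cong-≗ λ i → ∑words-*ˡ n L c (F ∘ (i ∷_))) (sym (*-distribˡ-sum {n} c _))

∑words-zero : ∀ n L {F : Vec (Fin n) L → ℕ} → (∀ w → F w ≡ 0) → ∑words n L F ≡ 0
∑words-zero n L eq = trans (∑words-cong n L eq) (∑words-*ˡ n L 0 λ _ → 0)

∑words-sum : ∀ n L (F : Fin m → Vec (Fin n) L → ℕ) →
             ∑words n L (λ w → sum λ i → F i w) ≡ sum λ i → ∑words n L (F i)
∑words-sum n zero    F = refl
∑words-sum {m} n (suc L) F =
  trans (sum-cong-≗ λ j → ∑words-sum n L λ i w → F i (j ∷ w)) (∑-comm {n} {m} _)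

∑words-*-interchange : ∀ n L a b (F G : Vec (Fin n) L → ℕ) →
  ∑words n L (λ w → (a * F w) * (b * G w)) ≡ (a * b) * ∑words n L (λ w → F w * G w)
∑words-*-interchange n L a b F G =
  trans (∑words-cong n L λ w → interchange a (F w) b (G w)) (∑words-*ˡ n L (a * b) _)

module _ {A : Set} {P Q : A → Set} (P? : Decidable P) (Q? : Decidable Q) where
  length-filter-filter : ∀ xs → List.length (List.filter P? (List.filter Q? xs)) ≡
                                sumₗ (List.map (λ x → ind (Q? x) * ind (P? x)) xs)
  length-filter-filter [] = refl
  length-filter-filter (x ∷ xs) with Q? x
  ... | no  _ = length-filter-filter xs
  ... | yes _ with P? x
  ...   | no  _ = length-filter-filter xs
  ...   | yes _ = cong suc (length-filter-filter xs)

sum-map-words : ∀ n L (F : Vec (Fin n) L → ℕ) → sumₗ (List.map F (words n L)) ≡ ∑words n L F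
sum-map-words n zero    F = +-identityʳ _
sum-map-words n (suc L) F = rows n (λ i → i)
  where
  -- `allFin n` is a tabulation; an arbitrary `g` lets the induction drop its first entry.
  rows : ∀ k (g : Fin k → Fin n) →
    sumₗ (List.map F (List.cartesianProductWith _∷_ (List.tabulate g) (words n L))) ≡
    sum (λ i → ∑words n L λ w → F (g i ∷ w))
  rows zero    g = refl
  rows (suc k) g = begin
    sumₗ (List.map F (List.map (g zero ∷_) (words n L) ++ rest))
      ≡⟨ cong sumₗ (List.map-++ F (List.map (g zero ∷_) (words n L)) rest) ⟩
    sumₗ (List.map F (List.map (g zero ∷_) (words n L)) ++ List.map F rest)
      ≡⟨ sum-++ (List.map F (List.map (g zero ∷_) (words n L))) _ ⟩
    sumₗ (List.map F (List.map (g zero ∷_) (words n L))) + sumₗ (List.map F rest)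
      ≡⟨ cong₂ _+_ (trans (cong sumₗ (sym (List.map-∘ (words n L))))
                          (sum-map-words n L λ w → F (g zero ∷ w)))
                   (rows k (g ∘ suc)) ⟩
    sum (λ i → ∑words n L λ w → F (g i ∷ w)) ∎
    where
    open ≡-Reasoning
    rest = List.cartesianProductWith _∷_ (List.tabulate (g ∘ suc)) (words n L)

countPermutations-∑words : {P : Vec (Fin n) n → Set} (P? : Decidable P) →
  countPermutations P? ≡ ∑words n n λ w → ind (unique? w) * ind (P? w)
countPermutations-∑words {n} P? =
  trans (length-filter-filter P? unique? (words n n)) (sum-map-words n n _)

∑perms : ∀ n → (Vec (Fin n) n → ℕ) → ℕ
∑perms n F = ∑words n n λ w → ind (unique? w) * F w

∑perms-cong : ∀ n {F G : Vec (Fin n) n → ℕ} → (∀ w → Unique w → F w ≡ G w) → ∑perms n F ≡ ∑perms n G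
∑perms-cong n eq = ∑words-cong n n λ w → indicator-*-cong (ind-indicator (unique? w)) (eq w)

∑perms-+ : ∀ n (F G : Vec (Fin n) n → ℕ) →
           ∑perms n (λ w → F w + G w) ≡ ∑perms n F + ∑perms n G
∑perms-+ n F G = trans (∑words-cong n n λ w → *-distribˡ-+ (ind (unique? w)) (F w) (G w))
                       (∑words-+ n n _ _)

∑perms-sum : ∀ n (F : Fin m → Vec (Fin n) n → ℕ) →
             ∑perms n (λ w → sum λ i → F i w) ≡ sum λ i → ∑perms n (F i)
∑perms-sum {m} n F =
  trans (∑words-cong n n λ w → *-distribˡ-sum (ind (unique? w)) (λ i → F i w))
        (∑words-sum {m} n n _)

∑perms-*ʳ : ∀ n (F : Vec (Fin n) n → ℕ) c → ∑perms n (λ w → F w * c) ≡ ∑perms n F * c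
∑perms-*ʳ n F c = trans
  (∑words-cong n n λ w → trans (sym (*-assoc (ind (unique? w)) (F w) c)) (*-comm _ c))
  (trans (∑words-*ˡ n n c _) (*-comm c _))

All-≢⇒∉ : {x : Fin n} {w : Vec (Fin n) L} → All (x ≢_) w → x ∉ w
All-≢⇒∉ (x≢y ∷ _) (here x≡y)  = x≢y x≡y
All-≢⇒∉ (_ ∷ all) (there x∈w) = All-≢⇒∉ all x∈w

∉⇒All-≢ : {x : Fin n} (w : Vec (Fin n) L) → x ∉ w → All (x ≢_) w
∉⇒All-≢ []      _   = []
∉⇒All-≢ (_ ∷ w) x∉w = (x∉w ∘ here) ∷ ∉⇒All-≢ w (x∉w ∘ there)

unique-length≤ : {w : Vec (Fin n) L} → Unique w → L ≤ n
unique-length≤ {w = w} uw = Fin.injective⇒≤ {f = lookup w} (lookup-injective uw _ _)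

-- Pigeonhole: a missing `x` put in front would give `suc n` distinct letters.
unique-complete : {w : Vec (Fin n) n} → Unique w → ∀ x → x ∈ w
unique-complete {n} {w} uw x with any? (x ≟_) w
... | yes x∈w = x∈w
... | no  x∉w = ⊥-elim (<-irrefl refl (unique-length≤ (∉⇒All-≢ w x∉w ∷ uw)))

-- Decomposing the permutations of [n + 1]

unique-toList : {w : Vec (Fin n) L} → Unique w ⇔ List.Unique (toList w)
unique-toList = mk⇔ to′ from′
  where
  to′ : {w : Vec (Fin n) L} → Unique w → List.Unique (toList w)
  to′ []       = []
  to′ (x ∷ uw) = All.toList⁺ x ∷ to′ uw
  from′ : {w : Vec (Fin n) L} → List.Unique (toList w) → Unique w
  from′ {w = []}    []       = []
  from′ {w = _ ∷ _} (x ∷ uw) = All.toList⁻ x ∷ from′ uw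

unique-resp-↭ : {v w : Vec (Fin n) L} → toList v ↭ toList w → Unique v ⇔ Unique w
unique-resp-↭ {n} p = mk⇔ (go p) (go (↭-sym p))
  where
  open import Data.List.Relation.Binary.Permutation.Setoid.Properties (setoid (Fin n)) using (Unique-resp-↭)
  go : ∀ {L} {v w : Vec (Fin n) L} → toList v ↭ toList w → Unique v → Unique w
  go p = from unique-toList ∘ Unique-resp-↭ (↭⇒↭ₛ p) ∘ to unique-toList

insertAt-↭ : (w : Vec (Fin n) L) (p : Fin (suc L)) (x : Fin n) → toList (insertAt w p x) ↭ toList (x ∷ w)
insertAt-↭ w       zero    x = ↭.refl
insertAt-↭ (y ∷ w) (suc p) x = ↭.trans (prep y (insertAt-↭ w p x)) (swap y x ↭.refl)

exchange-↭ : (w : Vec (Fin n) L) (i : Fin L) (x : Fin n) →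
             toList (lookup w i ∷ w [ i ]≔ x) ↭ toList (x ∷ w)
exchange-↭ (y ∷ w) zero    x = swap y x ↭.refl
exchange-↭ (y ∷ w) (suc i) x =
  ↭.trans (swap (lookup w i) y ↭.refl) (↭.trans (prep y (exchange-↭ w i x)) (swap y x ↭.refl))

zero≢-map-suc : (u : Vec (Fin n) L) → All (zero ≢_) (Vec.map Fin.suc u)
zero≢-map-suc []      = []
zero≢-map-suc (_ ∷ u) = (λ ()) ∷ zero≢-map-suc u

unique-map-suc⁻ : (u : Vec (Fin n) L) → Unique (Vec.map Fin.suc u) → Unique u
unique-map-suc⁻ []      []        = []
unique-map-suc⁻ (x ∷ u) (x∉ ∷ uu) =
  All.map (λ sx≢sy x≡y → sx≢sy (cong suc x≡y)) (All.map⁻ x∉) ∷ unique-map-suc⁻ u uu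

unique-zero∷map-suc : (u : Vec (Fin n) L) → Unique (zero ∷ Vec.map Fin.suc u) ⇔ Unique u
unique-zero∷map-suc u = mk⇔ (λ { (_ ∷ uu) → unique-map-suc⁻ u uu })
                            (λ uu → zero≢-map-suc u ∷ map⁺ Fin.suc-injective uu)

-- Like `oneZero`, defined by recursion on the first letter, so that the summands of `∑words` for
-- `zero` and `suc i` reduce by computation.
noZero : Vec (Fin (suc n)) L → ℕ
noZero []          = 1
noZero (zero  ∷ w) = 0
noZero (suc _ ∷ w) = noZero w

oneZero : Vec (Fin (suc n)) L → ℕ
oneZero []          = 0
oneZero (zero  ∷ w) = noZero w
oneZero (suc _ ∷ w) = oneZero w

noZero≡1 : {w : Vec (Fin (suc n)) L} → All (zero ≢_) w → noZero w ≡ 1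
noZero≡1 []                        = refl
noZero≡1 {w = zero  ∷ _} (0≢0 ∷ _) = ⊥-elim (0≢0 refl)
noZero≡1 {w = suc _ ∷ _} (_ ∷ all) = noZero≡1 all

noZero+oneZero≡1 : {w : Vec (Fin (suc n)) L} → Unique w → noZero w + oneZero w ≡ 1
noZero+oneZero≡1 []                       = refl
noZero+oneZero≡1 {w = zero  ∷ _} (0∉ ∷ _) = noZero≡1 0∉
noZero+oneZero≡1 {w = suc _ ∷ _} (_ ∷ uw) = noZero+oneZero≡1 uw

∑words-noZero : ∀ n L (F : Vec (Fin (suc n)) L → ℕ) →
  ∑words (suc n) L (λ w → noZero w * F w) ≡ ∑words n L (F ∘ Vec.map suc)
∑words-noZero n zero    F = *-identityˡ _
∑words-noZero n (suc L) F = cong₂ _+_ (∑words-zero (suc n) L λ _ → refl)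
  (sum-cong-≗ λ i → ∑words-noZero n L λ w → F (suc i ∷ w))

-- A word with exactly one `zero` is determined by its other letters and the place of the `zero`.
∑words-oneZero : ∀ n L (F : Vec (Fin (suc n)) (suc L) → ℕ) →
  ∑words (suc n) (suc L) (λ w → oneZero w * F w) ≡
  ∑words n L (λ u → sum λ p → F (insertAt (Vec.map suc u) p zero))
∑words-oneZero n zero    F =
  cong₂ _+_ (*-identityˡ (F (zero ∷ []))) (sum-zero λ (_ : Fin n) → refl)
∑words-oneZero n (suc L) F = begin
  ∑words (suc n) (suc L) (λ w → noZero w * F (zero ∷ w)) +
    sum (λ i → ∑words (suc n) (suc L) λ w → oneZero w * F (suc i ∷ w))
    ≡⟨ cong₂ _+_ (∑words-noZero n (suc L) λ w → F (zero ∷ w))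
                 (sum-cong-≗ λ i → ∑words-oneZero n L λ w → F (suc i ∷ w)) ⟩
  ∑words n (suc L) (λ u → F (zero ∷ Vec.map suc u)) +
    ∑words n (suc L) (λ u → sum λ p → F (insertAt (Vec.map suc u) (suc p) zero))
    ≡⟨ ∑words-+ n (suc L) (λ u → F (zero ∷ Vec.map suc u))
                          (λ u → sum λ p → F (insertAt (Vec.map suc u) (suc p) zero)) ⟨
  ∑words n (suc L) (λ u → sum λ p → F (insertAt (Vec.map suc u) p zero)) ∎
  where open ≡-Reasoning

-- `y` is the letter displaced by the `zero` of `w`: putting it back gives `u`, and `i` is the
-- place.
∑words-exchange : ∀ n L (H : Fin n → Vec (Fin (suc n)) L → ℕ) →
  sum (λ y → ∑words (suc n) L λ w → oneZero w * H y w) ≡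
  ∑words n L (λ u → sum λ i → H (lookup u i) (Vec.map suc u [ i ]≔ zero))
∑words-exchange n zero    H = sum-zero λ (_ : Fin n) → refl
∑words-exchange n (suc L) H = begin
  sum (λ y → ∑words (suc n) L (λ w → noZero w * H y (zero ∷ w)) +
             sum λ z → ∑words (suc n) L λ w → oneZero w * H y (suc z ∷ w))
    ≡⟨ ∑-distrib-+ {n} _ _ ⟩
  sum (λ y → ∑words (suc n) L λ w → noZero w * H y (zero ∷ w)) +
    sum (λ y → sum λ z → ∑words (suc n) L λ w → oneZero w * H y (suc z ∷ w))
    ≡⟨ cong₂ _+_ (sum-cong-≗ λ y → ∑words-noZero n L λ w → H y (zero ∷ w))
                 (∑-comm {n} {n} λ y z → ∑words (suc n) L λ w → oneZero w * H y (suc z ∷ w)) ⟩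
  sum (λ y → ∑words n L (A y)) +
    sum (λ z → sum λ y → ∑words (suc n) L λ w → oneZero w * H y (suc z ∷ w))
    ≡⟨ cong (sum (λ y → ∑words n L (A y)) +_)
            (sum-cong-≗ λ z → ∑words-exchange n L λ y w → H y (suc z ∷ w)) ⟩
  sum (λ y → ∑words n L (A y)) + sum (λ z → ∑words n L (B z))
    ≡⟨ ∑-distrib-+ {n} (λ y → ∑words n L (A y)) (λ z → ∑words n L (B z)) ⟨
  sum (λ z → ∑words n L (A z) + ∑words n L (B z))
    ≡⟨ sum-cong-≗ (λ z → ∑words-+ n L (A z) (B z)) ⟨
  ∑words n (suc L) (λ u → sum λ i → H (lookup u i) (Vec.map suc u [ i ]≔ zero)) ∎
  where
  open ≡-Reasoning
  A B : Fin n → Vec (Fin n) L → ℕ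
  A y u = H y (zero ∷ Vec.map suc u)
  B z u = sum λ i → H (lookup u i) (suc z ∷ Vec.map suc u [ i ]≔ zero)

-- `R` forces distinct letters and excludes words without `zero`, so every word counted has exactly
-- one. `R` is general in order to serve for `Unique w` and for `Unique (suc y ∷ w)`.
∑words-unique-split : ∀ n L {R : Vec (Fin (suc n)) L → Set} {a : Vec (Fin (suc n)) L → ℕ}
  (F : Vec (Fin (suc n)) L → ℕ) → (∀ w → Indicator (R w) (a w)) → (∀ w → R w → Unique w) →
  (∀ u → ¬ R (Vec.map suc u)) →
  ∑words (suc n) L (λ w → a w * F w) ≡ ∑words (suc n) L (λ w → oneZero w * (a w * F w))
∑words-unique-split n L {a = a} F ind-a R⇒unique ¬R = begin
  ∑words (suc n) L (λ w → a w * F w)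
    ≡⟨ ∑words-cong (suc n) L (λ w → split w (ind-a w)) ⟩
  ∑words (suc n) L (λ w → noZero w * (a w * F w) + oneZero w * (a w * F w))
    ≡⟨ ∑words-+ (suc n) L _ _ ⟩
  ∑words (suc n) L (λ w → noZero w * (a w * F w)) + ∑words (suc n) L (λ w → oneZero w * (a w * F w))
    ≡⟨ cong (_+ ∑words (suc n) L (λ w → oneZero w * (a w * F w)))
       (trans (∑words-noZero n L λ w → a w * F w)
              (∑words-zero n L λ u → cong (_* F (Vec.map suc u)) (indicator-no (ind-a (Vec.map suc u)) (¬R u)))) ⟩
  ∑words (suc n) L (λ w → oneZero w * (a w * F w)) ∎
  where
  open ≡-Reasoning
  split : ∀ w {c} → Indicator _ c → c * F w ≡ noZero w * (c * F w) + oneZero w * (c * F w)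
  split w (zero _) = sym (cong₂ _+_ (*-zeroʳ (noZero w)) (*-zeroʳ (oneZero w)))
  split w (one r)  = begin
    1 * F w                                       ≡⟨ *-identityˡ (1 * F w) ⟨
    1 * (1 * F w)                                 ≡⟨ cong (_* (1 * F w)) (noZero+oneZero≡1 (R⇒unique w r)) ⟨
    (noZero w + oneZero w) * (1 * F w)            ≡⟨ *-distribʳ-+ (1 * F w) (noZero w) (oneZero w) ⟩
    noZero w * (1 * F w) + oneZero w * (1 * F w)  ∎

¬unique-map-suc : (u : Vec (Fin n) (suc n)) → ¬ Unique (Vec.map Fin.suc u)
¬unique-map-suc u uu = <-irrefl refl (unique-length≤ (unique-map-suc⁻ u uu))

∑perms-insertAt : ∀ n (F : Vec (Fin (suc n)) (suc n) → ℕ) →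
  ∑perms (suc n) F ≡ ∑perms n (λ u → sum λ p → F (insertAt (Vec.map suc u) p zero))
∑perms-insertAt n F = begin
  ∑perms (suc n) F
    ≡⟨ ∑words-unique-split n (suc n) F (ind-indicator ∘ unique?) (λ _ uw → uw) ¬unique-map-suc ⟩
  ∑words (suc n) (suc n) (λ w → oneZero w * (ind (unique? w) * F w))
    ≡⟨ ∑words-oneZero n n (λ w → ind (unique? w) * F w) ⟩
  ∑words n n (λ u → sum λ p → ind (unique? (ins u p)) * F (ins u p))
    ≡⟨ ∑words-cong n n (λ u → trans
         (sum-cong-≗ λ p → cong (_* F (ins u p)) (ind-cong (unique? (ins u p)) (unique? u) (unique-ins u p)))
         (sym (*-distribˡ-sum (ind (unique? u)) (λ p → F (ins u p))))) ⟩
  ∑perms n (λ u → sum λ p → F (ins u p)) ∎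
  where
  open ≡-Reasoning
  ins : Vec (Fin n) n → Fin (suc n) → Vec (Fin (suc n)) (suc n)
  ins u p = insertAt (Vec.map suc u) p zero
  unique-ins : ∀ u p → Unique (ins u p) ⇔ Unique u
  unique-ins u p = mk⇔
    (to (unique-zero∷map-suc u) ∘ to (unique-resp-↭ (insertAt-↭ (Vec.map suc u) p zero)))
    (from (unique-resp-↭ (insertAt-↭ (Vec.map suc u) p zero)) ∘ from (unique-zero∷map-suc u))

-- Up to the shift by `suc`, `zero` is sent to `lookup u i` and `i` to `zero`: the new point is
-- fixed or enters the cycle of `u` right after `i`.
∑perms-exchange : ∀ n (F : Vec (Fin (suc n)) (suc n) → ℕ) →
  ∑perms (suc n) F ≡ ∑perms n (λ u → F (zero ∷ Vec.map suc u) +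
                                     sum λ i → F (suc (lookup u i) ∷ Vec.map suc u [ i ]≔ zero))
∑perms-exchange n F = begin
  ∑words (suc n) n (λ w → ind (unique? (zero ∷ w)) * F (zero ∷ w)) +
    sum (λ y → ∑words (suc n) n λ w → ind (unique? (suc y ∷ w)) * F (suc y ∷ w))
    ≡⟨ cong₂ _+_ fixed (sum-cong-≗ moved) ⟩
  ∑perms n (λ u → F (zero ∷ Vec.map suc u)) +
    sum (λ y → ∑words (suc n) n λ w → oneZero w * (ind (unique? (suc y ∷ w)) * F (suc y ∷ w)))
    ≡⟨ cong (∑perms n (λ u → F (zero ∷ Vec.map suc u)) +_)
            (∑words-exchange n n λ y w → ind (unique? (suc y ∷ w)) * F (suc y ∷ w)) ⟩
  ∑perms n (λ u → F (zero ∷ Vec.map suc u)) +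
    ∑words n n (λ u → sum λ i → ind (unique? (ex u i)) * F (ex u i))
    ≡⟨ cong (∑perms n (λ u → F (zero ∷ Vec.map suc u)) +_) (∑words-cong n n λ u → trans
         (sum-cong-≗ λ i → cong (_* F (ex u i)) (ind-cong (unique? (ex u i)) (unique? u) (unique-ex u i)))
         (sym (*-distribˡ-sum (ind (unique? u)) (λ i → F (ex u i))))) ⟩
  ∑perms n (λ u → F (zero ∷ Vec.map suc u)) + ∑perms n (λ u → sum λ i → F (ex u i))
    ≡⟨ ∑perms-+ n (λ u → F (zero ∷ Vec.map suc u)) (λ u → sum λ i → F (ex u i)) ⟨
  ∑perms n (λ u → F (zero ∷ Vec.map suc u) + sum λ i → F (ex u i)) ∎
  where
  open ≡-Reasoning
  ex : Vec (Fin n) n → Fin n → Vec (Fin (suc n)) (suc n)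
  ex u i = suc (lookup u i) ∷ Vec.map suc u [ i ]≔ zero
  unique-ex : ∀ u i → Unique (ex u i) ⇔ Unique u
  unique-ex u i = mk⇔
    (to (unique-zero∷map-suc u) ∘ to (unique-resp-↭ ex-↭))
    (from (unique-resp-↭ ex-↭) ∘ from (unique-zero∷map-suc u))
    where
    ex-↭ : toList (ex u i) ↭ toList (zero ∷ Vec.map suc u)
    ex-↭ = subst (λ y → toList (y ∷ Vec.map suc u [ i ]≔ zero) ↭ toList (zero ∷ Vec.map suc u))
                 (lookup-map i suc u) (exchange-↭ (Vec.map suc u) i zero)
  fixed : ∑words (suc n) n (λ w → ind (unique? (zero ∷ w)) * F (zero ∷ w)) ≡
          ∑perms n (λ u → F (zero ∷ Vec.map suc u))
  fixed = begin
    ∑words (suc n) n (λ w → ind (unique? (zero ∷ w)) * F (zero ∷ w))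
      ≡⟨ ∑words-cong (suc n) n (λ w → split w (ind-indicator (unique? (zero ∷ w)))) ⟩
    ∑words (suc n) n (λ w → noZero w * (ind (unique? (zero ∷ w)) * F (zero ∷ w)))
      ≡⟨ ∑words-noZero n n (λ w → ind (unique? (zero ∷ w)) * F (zero ∷ w)) ⟩
    ∑words n n (λ u → ind (unique? (zero ∷ Vec.map suc u)) * F (zero ∷ Vec.map suc u))
      ≡⟨ ∑words-cong n n (λ u → cong (_* F (zero ∷ Vec.map suc u))
           (ind-cong (unique? (zero ∷ Vec.map suc u)) (unique? u) (unique-zero∷map-suc u))) ⟩
    ∑perms n (λ u → F (zero ∷ Vec.map suc u)) ∎
    where
    split : ∀ w {c} → Indicator (Unique (zero ∷ w)) c → c * F (zero ∷ w) ≡ noZero w * (c * F (zero ∷ w))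
    split w (zero _)       = sym (*-zeroʳ (noZero w))
    split w (one (0∉ ∷ _)) =
      sym (trans (cong (_* (1 * F (zero ∷ w))) (noZero≡1 0∉)) (*-identityˡ (1 * F (zero ∷ w))))
  -- The first letter is not `zero`, so by pigeonhole the tail contains it.
  moved : ∀ y → ∑words (suc n) n (λ w → ind (unique? (suc y ∷ w)) * F (suc y ∷ w)) ≡
                ∑words (suc n) n (λ w → oneZero w * (ind (unique? (suc y ∷ w)) * F (suc y ∷ w)))
  moved y = ∑words-unique-split n n (λ w → F (suc y ∷ w)) (λ w → ind-indicator (unique? (suc y ∷ w)))
              (λ { _ (_ ∷ uw) → uw }) (λ u → ¬unique-map-suc (y ∷ u))

-- Statistics with the distribution of the number of non-fixed points

-- Both sides count the `suc k`-subsets of an `n`-set with a marked element.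
C-absorption : ∀ n k → (n C suc k) * suc k ≡ (n C k) * (n ∸ k)
C-absorption zero    zero    = refl
C-absorption zero    (suc k) = refl
C-absorption (suc n) zero    =
  trans (*-identityʳ (suc n C 1)) (trans (nC1≡n (suc n)) (sym (*-identityˡ (suc n))))
C-absorption (suc n) (suc k) = begin
  (suc n C suc (suc k)) * suc (suc k)
    ≡⟨ cong (_* suc (suc k)) (nCk+nC[k+1]≡[n+1]C[k+1] n (suc k)) ⟨
  ((n C suc k) + (n C suc (suc k))) * suc (suc k)
    ≡⟨ *-distribʳ-+ (suc (suc k)) (n C suc k) _ ⟩
  (n C suc k) * suc (suc k) + (n C suc (suc k)) * suc (suc k)
    ≡⟨ cong₂ _+_ (*-suc (n C suc k) (suc k)) (C-absorption n (suc k)) ⟩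
  (n C suc k) + (n C suc k) * suc k + (n C suc k) * (n ∸ suc k)
    ≡⟨ cong (λ x → (n C suc k) + x + (n C suc k) * (n ∸ suc k)) (C-absorption n k) ⟩
  (n C suc k) + (n C k) * (n ∸ k) + (n C suc k) * (n ∸ suc k)
    ≡⟨ solve 3 (λ a b c → a :+ b :+ c := b :+ (a :+ c)) refl (n C suc k) ((n C k) * (n ∸ k)) _ ⟩
  (n C k) * (n ∸ k) + ((n C suc k) + (n C suc k) * (n ∸ suc k))
    ≡⟨ cong ((n C k) * (n ∸ k) +_) (rearrange (suc k ≤? n)) ⟩
  (n C k) * (n ∸ k) + (n C suc k) * (n ∸ k)
    ≡⟨ *-distribʳ-+ (n ∸ k) (n C k) _ ⟨
  ((n C k) + (n C suc k)) * (n ∸ k)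
    ≡⟨ cong (_* (n ∸ k)) (nCk+nC[k+1]≡[n+1]C[k+1] n k) ⟩
  (suc n C suc k) * (n ∸ k) ∎
  where
  open ≡-Reasoning
  open +-*-Solver
  -- For `n ≤ k` the truncated differences do not fit together, but then `n C suc k` is 0.
  rearrange : Dec (k < n) → (n C suc k) + (n C suc k) * (n ∸ suc k) ≡ (n C suc k) * (n ∸ k)
  rearrange (yes k<n) = trans (sym (*-suc (n C suc k) (n ∸ suc k)))
                              (cong ((n C suc k) *_) (sym (+-∸-assoc 1 k<n)))
  rearrange (no k≮n)  rewrite k>n⇒nCk≡0 {n} {suc k} (s≤s (≮⇒≥ k≮n)) = refl

δ : ℕ → ℕ → ℕ
δ a b = ind (a ℕ.≟ b)

δ-subst : ∀ (f : ℕ → ℕ) a b → f a * δ a b ≡ δ a b * f b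
δ-subst f a b = go (ind-indicator (a ℕ.≟ b))
  where
  go : ∀ {c} → Indicator (a ≡ b) c → f a * c ≡ c * f b
  go (one refl) = *-comm (f a) 1
  go (zero _)   = *-zeroʳ (f a)

-- The derangement numbers by their two-term recurrence; `derangements≡!` identifies them with the
-- count.
!_ : ℕ → ℕ
! 0           = 1
! 1           = 0
! suc (suc k) = suc k * (! suc k + ! k)

-- The recurrence obeyed by the number of non-fixed points when a new point is
-- added as a fixed point, after one of the n ∸ g fixed points, or after one of
-- the g others.
record NonfixedStatistic (g : ∀ n → Vec (Fin n) n → ℕ) : Set where
  field
    base : g 0 [] ≡ 0
    step : ∀ n (F : ℕ → ℕ) → ∑perms (suc n) (F ∘ g (suc n)) ≡
      ∑perms n (λ u → F (g n u) + ((n ∸ g n u) * F (2 + g n u) + g n u * F (1 + g n u)))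

module _ {g : ∀ n → Vec (Fin n) n → ℕ} (stat : NonfixedStatistic g) where
  open NonfixedStatistic stat

  -- Applied to the indicator of a value, `step` determines the distribution by induction on `n`;
  -- the closed form obeys the same recurrence by `C-absorption`, the recurrence of `!_` and
  -- Pascal's rule.
  distribution : ∀ n k → ∑perms n (λ u → δ (g n u) k) ≡ (n C k) * ! k
  distribution zero zero rewrite base = refl
  distribution zero (suc k) rewrite base = refl
  distribution (suc n) zero = begin
    ∑perms (suc n) (λ u → δ (g (suc n) u) 0)
      ≡⟨ step n (λ x → δ x 0) ⟩
    ∑perms n (λ u → δ (g n u) 0 + ((n ∸ g n u) * 0 + g n u * 0))
      ≡⟨ ∑perms-cong n (λ u _ → trans (cong (δ (g n u) 0 +_)
           (cong₂ _+_ (*-zeroʳ (n ∸ g n u)) (*-zeroʳ (g n u)))) (+-identityʳ _)) ⟩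
    ∑perms n (λ u → δ (g n u) 0)
      ≡⟨ distribution n 0 ⟩
    (n C 0) * 1 ∎
    where open ≡-Reasoning
  distribution (suc n) (suc zero) = begin
    ∑perms (suc n) (λ u → δ (g (suc n) u) 1)
      ≡⟨ step n (λ x → δ x 1) ⟩
    ∑perms n (λ u → δ (g n u) 1 + ((n ∸ g n u) * 0 + g n u * δ (g n u) 0))
      -- The value 1 could arise from 0 by adding one, but that happens with weight `g n u`, which
      -- is 0 there.
      ≡⟨ ∑perms-cong n (λ u _ → trans (cong (δ (g n u) 1 +_)
           (cong₂ _+_ (*-zeroʳ (n ∸ g n u))
                      (trans (δ-subst (λ x → x) (g n u) 0) (*-zeroʳ (δ (g n u) 0))))) (+-identityʳ _)) ⟩
    ∑perms n (λ u → δ (g n u) 1)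
      ≡⟨ distribution n 1 ⟩
    (n C 1) * 0
      ≡⟨ *-zeroʳ (n C 1) ⟩
    0
      ≡⟨ *-zeroʳ (suc n C 1) ⟨
    (suc n C 1) * 0 ∎
    where open ≡-Reasoning
  distribution (suc n) (suc (suc k)) = begin
    ∑perms (suc n) (λ u → δ (g (suc n) u) (2 + k))
      ≡⟨ step n (λ x → δ x (2 + k)) ⟩
    ∑perms n (λ u → δ (g n u) (2 + k) + ((n ∸ g n u) * δ (g n u) k + g n u * δ (g n u) (1 + k)))
      ≡⟨ ∑perms-cong n (λ u _ → cong (δ (g n u) (2 + k) +_)
           (cong₂ _+_ (δ-subst (n ∸_) (g n u) k) (δ-subst (λ x → x) (g n u) (1 + k)))) ⟩
    ∑perms n (λ u → δ (g n u) (2 + k) + (δ (g n u) k * (n ∸ k) + δ (g n u) (1 + k) * (1 + k)))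
      ≡⟨ trans (∑perms-+ n (λ u → δ (g n u) (2 + k)) _) (cong (∑perms n (λ u → δ (g n u) (2 + k)) +_)
           (trans (∑perms-+ n (λ u → δ (g n u) k * (n ∸ k)) (λ u → δ (g n u) (1 + k) * (1 + k)))
             (cong₂ _+_ (∑perms-*ʳ n (λ u → δ (g n u) k) (n ∸ k))
                        (∑perms-*ʳ n (λ u → δ (g n u) (1 + k)) (1 + k))))) ⟩
    ∑perms n (λ u → δ (g n u) (2 + k)) +
      (∑perms n (λ u → δ (g n u) k) * (n ∸ k) + ∑perms n (λ u → δ (g n u) (1 + k)) * (1 + k))
      ≡⟨ cong₂ _+_ (distribution n (2 + k)) (cong₂ _+_
           (cong (_* (n ∸ k)) (distribution n k)) (cong (_* (1 + k)) (distribution n (1 + k)))) ⟩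
    (n C (2 + k)) * ! (2 + k) + ((n C k) * ! k * (n ∸ k) + (n C (1 + k)) * ! (1 + k) * (1 + k))
      ≡⟨ cong (λ x → (n C (2 + k)) * ! (2 + k) + (x + (n C (1 + k)) * ! (1 + k) * (1 + k)))
           (trans (swapʳ (n C k) (! k) (n ∸ k)) (cong (_* ! k) (sym (C-absorption n k)))) ⟩
    (n C (2 + k)) * (suc k * (! (1 + k) + ! k)) +
      ((n C (1 + k)) * suc k * ! k + (n C (1 + k)) * ! (1 + k) * (1 + k))
      ≡⟨ solve 5 (λ a b c d e → a :* (c :* (d :+ e)) :+ (b :* c :* e :+ b :* d :* c)
                              := (b :+ a) :* (c :* (d :+ e)))
           refl (n C (2 + k)) (n C (1 + k)) (suc k) (! (1 + k)) (! k) ⟩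
    ((n C (1 + k)) + (n C (2 + k))) * ! (2 + k)
      ≡⟨ cong (_* ! (2 + k)) (nCk+nC[k+1]≡[n+1]C[k+1] n (1 + k)) ⟩
    (suc n C (2 + k)) * ! (2 + k) ∎
    where
    open ≡-Reasoning
    open +-*-Solver
    swapʳ : ∀ a b c → a * b * c ≡ a * c * b
    swapʳ = solve 3 (λ a b c → a :* b :* c := a :* c :* b) refl

  -- Groups the permutations by the value of `g`, which `g n u ≤ n` confines to the range of the
  -- sum.
  ∑perms-statistic : ∀ n → (∀ u → g n u ≤ n) → (F : ℕ → ℕ) →
    ∑perms n (F ∘ g n) ≡ sum {suc n} (λ k → (n C toℕ k) * F (toℕ k) * ! toℕ k)
  ∑perms-statistic n g≤n F = begin
    ∑perms n (F ∘ g n)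
      ≡⟨ ∑perms-cong n (λ u _ → pointwise u) ⟩
    ∑perms n (λ u → sum {suc n} λ k → δ (g n u) (toℕ k) * F (toℕ k))
      ≡⟨ ∑perms-sum {suc n} n (λ k u → δ (g n u) (toℕ k) * F (toℕ k)) ⟩
    sum {suc n} (λ k → ∑perms n λ u → δ (g n u) (toℕ k) * F (toℕ k))
      ≡⟨ sum-cong-≗ {suc n} (λ k → trans (∑perms-*ʳ n (λ u → δ (g n u) (toℕ k)) (F (toℕ k)))
           (trans (cong (_* F (toℕ k)) (distribution n (toℕ k)))
                  (solve 3 (λ a b c → a :* b :* c := a :* c :* b) refl
                         (n C toℕ k) (! toℕ k) (F (toℕ k))))) ⟩
    sum {suc n} (λ k → (n C toℕ k) * F (toℕ k) * ! toℕ k) ∎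
    where
    open ≡-Reasoning
    open +-*-Solver
    pointwise : ∀ u → F (g n u) ≡ sum {suc n} λ k → δ (g n u) (toℕ k) * F (toℕ k)
    pointwise u = sym (begin
      sum {suc n} (λ k → δ (g n u) (toℕ k) * F (toℕ k))
        ≡⟨ sum-single k₀ (λ k k≢k₀ → cong (_* F (toℕ k)) (ind-no (g n u ℕ.≟ toℕ k)
             λ eq → k≢k₀ (Fin.toℕ-injective (trans (sym eq) (sym toℕ-k₀))))) ⟩
      δ (g n u) (toℕ k₀) * F (toℕ k₀)
        ≡⟨ cong (_* F (toℕ k₀)) (ind-yes (g n u ℕ.≟ toℕ k₀) (sym toℕ-k₀)) ⟩
      1 * F (toℕ k₀)
        ≡⟨ trans (*-identityˡ _) (cong F toℕ-k₀) ⟩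
      F (g n u) ∎)
      where
      k₀ = Fin.fromℕ< (s≤s (g≤n u))
      toℕ-k₀ : toℕ k₀ ≡ g n u
      toℕ-k₀ = Fin.toℕ-fromℕ< (s≤s (g≤n u))

-- `f` gives the letter with which each position is compared; passing to the tail shifts it.
nonfixed : (Fin L → Fin n) → Vec (Fin n) L → ℕ
nonfixed f []      = 0
nonfixed f (x ∷ w) = ind (¬? (x ≟ f zero)) + nonfixed (f ∘ suc) w

nonfixed≤ : (f : Fin L → Fin n) (w : Vec (Fin n) L) → nonfixed f w ≤ L
nonfixed≤ f []      = z≤n
nonfixed≤ f (x ∷ w) with x ≟ f zero
... | yes _ = m≤n⇒m≤1+n (nonfixed≤ (f ∘ suc) w)
... | no  _ = s≤s (nonfixed≤ (f ∘ suc) w)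

nonfixed-map-suc : (f : Fin L → Fin n) (u : Vec (Fin n) L) →
                   nonfixed (suc ∘ f) (Vec.map suc u) ≡ nonfixed f u
nonfixed-map-suc f []      = refl
nonfixed-map-suc f (x ∷ u) = cong (ind (¬? (x ≟ f zero)) +_) (nonfixed-map-suc (f ∘ suc) u)

-- Position `i` becomes non-fixed, and the new front position is counted by `1 +`: a fixed `i`
-- raises the count by two, any other by one.
sum-nonfixed-exchange : (f : Fin L → Fin n) (u : Vec (Fin n) L) (F : ℕ → ℕ) →
  sum (λ i → F (1 + nonfixed (suc ∘ f) (Vec.map suc u [ i ]≔ zero))) ≡
  (L ∸ nonfixed f u) * F (2 + nonfixed f u) + nonfixed f u * F (1 + nonfixed f u)
sum-nonfixed-exchange         f []      F = refl
sum-nonfixed-exchange {suc L} f (x ∷ u) F with x ≟ f zero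
... | yes _ rewrite nonfixed-map-suc (f ∘ suc) u
                  | sum-nonfixed-exchange (f ∘ suc) u F
                  | +-∸-assoc 1 (nonfixed≤ (f ∘ suc) u) =
  sym (+-assoc (F (2 + nonfixed (f ∘ suc) u)) _ _)
... | no  _ rewrite nonfixed-map-suc (f ∘ suc) u
                  | sum-nonfixed-exchange (f ∘ suc) u (F ∘ suc) =
  x∙yz≈y∙xz (F (2 + g)) ((L ∸ g) * F (3 + g)) (g * F (2 + g))
  where g = nonfixed (f ∘ suc) u

nonfixed-statistic : NonfixedStatistic (λ n → nonfixed (λ i → i))
nonfixed-statistic = record
  { base = refl
  ; step = λ n F → trans (∑perms-exchange n (F ∘ nonfixed (λ i → i))) (∑perms-cong n λ u _ →
      cong₂ _+_ (cong F (nonfixed-map-suc (λ i → i) u)) (sum-nonfixed-exchange (λ i → i) u F))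
  }

derangement⇔nonfixed : (f : Fin L → Fin n) (w : Vec (Fin n) L) →
                       (∀ i → lookup w i ≢ f i) ⇔ (nonfixed f w ≡ L)
derangement⇔nonfixed f w = mk⇔ (to′ f w) (from′ f w)
  where
  to′ : ∀ {L} (f : Fin L → Fin _) w → (∀ i → lookup w i ≢ f i) → nonfixed f w ≡ L
  to′ f []      _ = refl
  to′ f (x ∷ w) d with x ≟ f zero
  ... | yes eq = ⊥-elim (d zero eq)
  ... | no  _  = cong suc (to′ (f ∘ suc) w (d ∘ suc))
  from′ : ∀ {L} (f : Fin L → Fin _) w → nonfixed f w ≡ L → ∀ i → lookup w i ≢ f i
  from′ f (x ∷ w) eq i with x ≟ f zero
  from′ f (x ∷ w) eq _       | yes _ = ⊥-elim (<-irrefl refl (subst (_≤ _) eq (nonfixed≤ (f ∘ suc) w)))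
  from′ f (x ∷ w) eq zero    | no x≢ = x≢
  from′ f (x ∷ w) eq (suc i) | no _  = from′ (f ∘ suc) w (suc-injective eq) i

-- The case `k = n` of the distribution of ordinary non-fixed points.
derangements≡! : ∀ n → derangements n ≡ ! n
derangements≡! n = begin
  derangements n
    ≡⟨ countPermutations-∑words (derangement? {n}) ⟩
  ∑perms n (λ w → ind (derangement? w))
    ≡⟨ ∑perms-cong n (λ w _ → ind-cong (derangement? w) (nonfixed (λ i → i) w ℕ.≟ n)
                                         (derangement⇔nonfixed (λ i → i) w)) ⟩
  ∑perms n (λ w → δ (nonfixed (λ i → i) w) n)
    ≡⟨ distribution nonfixed-statistic n n ⟩
  (n C n) * ! n
    ≡⟨ trans (cong (_* ! n) (nCn≡1 n)) (*-identityˡ (! n)) ⟩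
  ! n ∎
  where open ≡-Reasoning

-- The fixed points of hat π are the left-to-right maxima of π that are last or
-- directly followed by another one.  Here mx is the strict upper bound set by
-- the letters read so far.

record? : ℕ → Fin n → Bool
record? mx x = mx ≤ᵇ toℕ x

infixl 6 _▹_
_▹_ : ℕ → Fin n → ℕ
mx ▹ x = mx ⊔ suc (toℕ x)

-- A right parenthesis stands before a record and also at the end of the word, hence `true`.
closed? : ℕ → Vec (Fin n) L → Bool
closed? mx []      = true
closed? mx (x ∷ w) = record? mx x

hatNonfixed : ℕ → Vec (Fin n) L → ℕ
hatNonfixed mx []      = 0
hatNonfixed mx (x ∷ w) =
  (if record? mx x ∧ closed? (mx ▹ x) w then 0 else 1) + hatNonfixed (mx ▹ x) w

hatNonfixed≤ : ∀ mx (w : Vec (Fin n) L) → hatNonfixed mx w ≤ L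
hatNonfixed≤ mx []      = z≤n
hatNonfixed≤ mx (x ∷ w) with record? mx x ∧ closed? (mx ▹ x) w
... | true  = m≤n⇒m≤1+n (hatNonfixed≤ (mx ▹ x) w)
... | false = s≤s (hatNonfixed≤ (mx ▹ x) w)

record?-suc : ∀ mx (x : Fin n) → record? (suc mx) (suc x) ≡ record? mx x
record?-suc zero     x = refl
record?-suc (suc mx) x = refl

closed?-map-suc : ∀ mx (u : Vec (Fin n) L) → closed? (suc mx) (Vec.map suc u) ≡ closed? mx u
closed?-map-suc mx []      = refl
closed?-map-suc mx (x ∷ u) = record?-suc mx x

closed?-insertAt : ∀ mx (u : Vec (Fin n) L) p →
                   closed? (suc mx) (insertAt (Vec.map suc u) (suc p) zero) ≡ closed? mx u
closed?-insertAt mx (x ∷ u) p = record?-suc mx x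

hatNonfixed-map-suc : ∀ mx (u : Vec (Fin n) L) →
                      hatNonfixed (suc mx) (Vec.map suc u) ≡ hatNonfixed mx u
hatNonfixed-map-suc mx []      = refl
hatNonfixed-map-suc mx (x ∷ u)
  rewrite record?-suc mx x
        | closed?-map-suc (mx ▹ x) u
        | hatNonfixed-map-suc (mx ▹ x) u = refl

-- Behind another letter the new least letter is no record, hence not fixed, and it separates the
-- letter before it from a following record. Behind a fixed letter the count grows by two, behind
-- any other by one.
sum-hatNonfixed-insertAt : ∀ mx (u : Vec (Fin n) L) (F : ℕ → ℕ) →
  sum (λ p → F (hatNonfixed (suc mx) (insertAt (Vec.map suc u) (suc p) zero))) ≡
  (L ∸ hatNonfixed mx u) * F (2 + hatNonfixed mx u) + hatNonfixed mx u * F (1 + hatNonfixed mx u)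
sum-hatNonfixed-insertAt         mx []      F = refl
sum-hatNonfixed-insertAt {L = suc L} mx (x ∷ u) F
  rewrite record?-suc mx x
        | ∧-zeroʳ (record? mx x)
        | ⊔-identityʳ (mx ▹ x)
        | hatNonfixed-map-suc (mx ▹ x) u
  = trans (cong (F (2 + hatNonfixed (mx ▹ x) u) +_)
            (sum-cong-≗ {L} λ p → cong (λ c → F ((if record? mx x ∧ c then 0 else 1) +
               hatNonfixed (suc (mx ▹ x)) (insertAt (Vec.map suc u) (suc p) zero)))
               (closed?-insertAt (mx ▹ x) u p)))
          (step (record? mx x ∧ closed? (mx ▹ x) u))
  where
  g = hatNonfixed (mx ▹ x) u
  step : ∀ b → F (2 + g) + sum (λ p → F ((if b then 0 else 1) +
                 hatNonfixed (suc (mx ▹ x)) (insertAt (Vec.map suc u) (suc p) zero))) ≡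
         let g′ = (if b then 0 else 1) + g in (suc L ∸ g′) * F (2 + g′) + g′ * F (1 + g′)
  step true  rewrite sum-hatNonfixed-insertAt (mx ▹ x) u F
                   | +-∸-assoc 1 (hatNonfixed≤ (mx ▹ x) u) = sym (+-assoc (F (2 + g)) _ _)
  step false rewrite sum-hatNonfixed-insertAt (mx ▹ x) u (F ∘ suc) =
    x∙yz≈y∙xz (F (2 + g)) ((L ∸ g) * F (3 + g)) (g * F (2 + g))

hatNonfixed-statistic : NonfixedStatistic (λ n → hatNonfixed 0)
hatNonfixed-statistic = record
  { base = refl
  ; step = λ n F → trans (∑perms-insertAt n (F ∘ hatNonfixed 0)) (∑perms-cong n λ u _ →
      cong₂ _+_ (cong F (front u))
                (trans (sum-cong-≗ λ p → cong F (behind u p)) (sum-hatNonfixed-insertAt 0 u F)))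
  }
  where
  -- In front the new letter is a record directly followed by another or by the end, hence fixed.
  front : (u : Vec (Fin n) L) → hatNonfixed 0 (zero ∷ Vec.map suc u) ≡ hatNonfixed 0 u
  front []      = refl
  front (x ∷ u) = hatNonfixed-map-suc 0 (x ∷ u)
  -- The first letter is a record over either bound.
  behind : (u : Vec (Fin n) L) (p : Fin L) →
    hatNonfixed 0 (insertAt (Vec.map suc u) (suc p) zero) ≡
    hatNonfixed 1 (insertAt (Vec.map suc u) (suc p) zero)
  behind (x ∷ u) p = refl

-- Shuffling r small letters into a word of big letters

permits : Bool → Bool → ℕ
permits p q = if p ∧ q then 0 else 1

-- The number of ways to shuffle r equal letters, smaller than all others, into
-- u so that no hat-fixed point remains; p tells whether the letter before u
-- becomes one unless a small letter or a non-record follows it.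
shuffles : Bool → ℕ → Vec (Fin n) L → ℕ → ℕ
shuffles p mx []      zero    = if p then 0 else 1
shuffles {n} p mx []  (suc r) = shuffles {n} false mx [] r
shuffles p mx (x ∷ u) zero    = permits p (record? mx x) * shuffles (record? mx x) (mx ▹ x) u 0
shuffles p mx (x ∷ u) (suc r) =
  shuffles false mx (x ∷ u) r + permits p (record? mx x) * shuffles (record? mx x) (mx ▹ x) u (suc r)

shuffles-true-zero : ∀ mx (u : Vec (Fin n) L) →
  shuffles true mx u 0 ≡ (if closed? mx u then 0 else shuffles false mx u 0)
shuffles-true-zero mx []      = refl
shuffles-true-zero mx (x ∷ u) with record? mx x
... | true  = refl
... | false = refl

-- If a record or the end comes next, the pending record needs a small letter at once, which uses
-- one up; otherwise it is already harmless.
shuffles-true-suc : ∀ mx (u : Vec (Fin n) L) r →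
  shuffles true mx u (suc r) ≡ (if closed? mx u then shuffles false mx u r else shuffles false mx u (suc r))
shuffles-true-suc {n} mx [] r = refl
shuffles-true-suc mx (x ∷ u) r with record? mx x
... | true  = +-identityʳ _
... | false = refl

-- Pascal's rule. A small letter in front leaves one fewer. With `x` in front the top also drops by
-- one: either `x` is a non-fixed letter that `u` no longer counts, or a fixed `x` uses up the small
-- letter behind it.
shuffles-C : ∀ mx (u : Vec (Fin n) L) r → shuffles false mx u r ≡ (r + hatNonfixed mx u) C L
shuffles-C mx []      zero    = refl
shuffles-C {n} mx []  (suc r) = shuffles-C {n} mx [] r
shuffles-C {L = suc L} mx (x ∷ u) zero    = trans (*-identityˡ _) (first (record? mx x))
  where
  g = hatNonfixed (mx ▹ x) u
  g<1+L : g < suc L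
  g<1+L = s≤s (hatNonfixed≤ (mx ▹ x) u)
  not-fixed : shuffles false (mx ▹ x) u 0 ≡ suc g C suc L
  not-fixed = begin
    shuffles false (mx ▹ x) u 0  ≡⟨ shuffles-C (mx ▹ x) u 0 ⟩
    g C L                        ≡⟨ +-identityʳ (g C L) ⟨
    (g C L) + 0                  ≡⟨ cong ((g C L) +_) (k>n⇒nCk≡0 g<1+L) ⟨
    (g C L) + (g C suc L)        ≡⟨ nCk+nC[k+1]≡[n+1]C[k+1] g L ⟩
    suc g C suc L                ∎
    where open ≡-Reasoning
  first : ∀ b → shuffles b (mx ▹ x) u 0 ≡ ((if b ∧ closed? (mx ▹ x) u then 0 else 1) + g) C suc L
  first false = not-fixed
  first true  = trans (shuffles-true-zero (mx ▹ x) u) (second (closed? (mx ▹ x) u))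
    where
    second : ∀ c → (if c then 0 else shuffles false (mx ▹ x) u 0) ≡ ((if c then 0 else 1) + g) C suc L
    second true  = sym (k>n⇒nCk≡0 g<1+L)
    second false = not-fixed
shuffles-C {L = suc L} mx (x ∷ u) (suc r) = trans
  (cong₂ _+_ (shuffles-C mx (x ∷ u) r) (*-identityˡ (shuffles (record? mx x) (mx ▹ x) u (suc r))))
  (first (record? mx x))
  where
  g = hatNonfixed (mx ▹ x) u
  open ≡-Reasoning
  not-fixed : ((r + suc g) C suc L) + shuffles false (mx ▹ x) u (suc r) ≡ (suc r + suc g) C suc L
  not-fixed = begin
    ((r + suc g) C suc L) + shuffles false (mx ▹ x) u (suc r)
      ≡⟨ cong₂ _+_ refl (trans (shuffles-C (mx ▹ x) u (suc r)) (cong (_C L) (sym (+-suc r g)))) ⟩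
    ((r + suc g) C suc L) + ((r + suc g) C L)
      ≡⟨ +-comm ((r + suc g) C suc L) _ ⟩
    ((r + suc g) C L) + ((r + suc g) C suc L)
      ≡⟨ nCk+nC[k+1]≡[n+1]C[k+1] (r + suc g) L ⟩
    (suc r + suc g) C suc L ∎
  first : ∀ b → let g′ = (if b ∧ closed? (mx ▹ x) u then 0 else 1) + g in
          ((r + g′) C suc L) + shuffles b (mx ▹ x) u (suc r) ≡ (suc r + g′) C suc L
  first false = not-fixed
  first true rewrite shuffles-true-suc (mx ▹ x) u r = second (closed? (mx ▹ x) u)
    where
    second : ∀ c → let g′ = (if c then 0 else 1) + g in
      ((r + g′) C suc L) + (if c then shuffles false (mx ▹ x) u r else shuffles false (mx ▹ x) u (suc r))
      ≡ (suc r + g′) C suc L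
    second true  = begin
      ((r + g) C suc L) + shuffles false (mx ▹ x) u r  ≡⟨ cong (((r + g) C suc L) +_) (shuffles-C (mx ▹ x) u r) ⟩
      ((r + g) C suc L) + ((r + g) C L)                ≡⟨ +-comm ((r + g) C suc L) _ ⟩
      ((r + g) C L) + ((r + g) C suc L)                ≡⟨ nCk+nC[k+1]≡[n+1]C[k+1] (r + g) L ⟩
      (suc r + g) C suc L                              ∎
    second false = not-fixed

-- Repetition-freeness as a product of conditions on prefixes, so that the factor of a letter can be
-- pulled out of the sums over later letters; `unique?` compares each letter with those that follow.
fresh : List (Fin n) → Vec (Fin n) L → ℕ
fresh used []      = 1
fresh used (x ∷ w) = ind (¬? (_∈?_ _≟_ x used)) * fresh (x ∷ used) w

fresh-indicator : (used : List (Fin n)) (w : Vec (Fin n) L) →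
                  Indicator (Unique w × (∀ x → x ∈ w → x ∉ₗ used)) (fresh used w)
fresh-indicator used []      = one ([] , λ _ ())
fresh-indicator {n} used (x ∷ w) = indicator-⇔ (mk⇔ join split)
  (indicator-× (ind-indicator (¬? (_∈?_ _≟_ x used))) (fresh-indicator (x ∷ used) w))
  where
  Fresh : ∀ {L} → List (Fin n) → Vec (Fin n) L → Set
  Fresh used w = Unique w × (∀ y → y ∈ w → y ∉ₗ used)
  join : x ∉ₗ used × Fresh (x ∷ used) w → Fresh used (x ∷ w)
  join (x∉used , uw , w∉) = (∉⇒All-≢ w (λ x∈w → w∉ x x∈w (here refl)) ∷ uw) ,
    λ { y (here refl) → x∉used ; y (there y∈w) → w∉ y y∈w ∘ there }
  split : Fresh used (x ∷ w) → x ∉ₗ used × Fresh (x ∷ used) w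
  split ((x∉w ∷ uw) , w∉) = w∉ x (here refl) , uw ,
    λ { y y∈w (here refl) → All-≢⇒∉ x∉w y∈w ; y y∈w (there y∈used) → w∉ y (there y∈w) y∈used }

fresh-unique : (w : Vec (Fin n) L) → fresh [] w ≡ ind (unique? w)
fresh-unique w = indicator-unique
  (indicator-⇔ (mk⇔ proj₁ (λ uw → uw , λ _ _ ())) (fresh-indicator [] w)) (ind-indicator (unique? w))

-- For the s + 1-st of n = s + 1 + N letters, `mid`, to be the largest fixed
-- point of hat π while the s smaller letters increase, π has to be accepted by
-- the automaton `start`.  In each state r small letters are still to be read.

module Automaton (s N : ℕ) where

  Letter : Set
  Letter = Fin (s + suc N)

  small : Fin s → Letter
  small k = k Fin.↑ˡ suc N

  mid : Letter
  mid = s Fin.↑ʳ zero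

  big : Fin N → Letter
  big b = s Fin.↑ʳ suc b

  data View : Letter → Set where
    isSmall : ∀ k → View (small k)
    isMid   : View mid
    isBig   : ∀ b → View (big b)

  view : ∀ x → View x
  view x with Fin.splitAt s x in eq
  ... | inj₁ k       = subst View (Fin.splitAt⁻¹-↑ˡ eq) (isSmall k)
  ... | inj₂ zero    = subst View (Fin.splitAt⁻¹-↑ʳ eq) isMid
  ... | inj₂ (suc b) = subst View (Fin.splitAt⁻¹-↑ʳ eq) (isBig b)

  classify : {A : Set} → (Fin s → A) → A → (Fin N → A) → Letter → A
  classify f a g x = [ f , (λ { zero → a ; (suc b) → g b }) ]′ (Fin.splitAt s x)

  module _ {A : Set} {f : Fin s → A} {a : A} {g : Fin N → A} where

    classify-small : ∀ k → classify f a g (small k) ≡ f k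
    classify-small k rewrite Fin.splitAt-↑ˡ s k (suc N) = refl

    classify-mid : classify f a g mid ≡ a
    classify-mid rewrite Fin.splitAt-↑ʳ s (suc N) zero = refl

    classify-big : ∀ b → classify f a g (big b) ≡ g b
    classify-big b rewrite Fin.splitAt-↑ʳ s (suc N) (suc b) = refl

  toℕ-small : ∀ k → toℕ (small k) ≡ toℕ k
  toℕ-small k = Fin.toℕ-↑ˡ k (suc N)

  toℕ-mid : toℕ mid ≡ s
  toℕ-mid = trans (Fin.toℕ-↑ʳ s zero) (+-identityʳ s)

  toℕ-big : ∀ b → toℕ (big b) ≡ s + suc (toℕ b)
  toℕ-big b = Fin.toℕ-↑ʳ s (suc b)

  sum-letters : (f : Letter → ℕ) → sum f ≡ sum (f ∘ small) + (f mid + sum (f ∘ big))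
  sum-letters f = sum-↑ s f

  -- Small letters have to come in increasing order, so `r` determines the next one; `f` is the
  -- continuation with one fewer left.
  expect : ℕ → (ℕ → ℕ) → Fin s → ℕ
  expect zero    f k = 0
  expect (suc r) f k = ind (toℕ k + suc r ℕ.≟ s) * f r

  -- The state once `mid` and a big letter are read; `p` marks the last letter as a record that may
  -- still become fixed. A small letter removes this danger and leaves `mx`, counted within the big
  -- letters, unchanged.
  rest : ℕ → Bool → ℕ → Vec Letter L → ℕ
  rest r p mx []      = if p then 0 else δ r 0
  rest r p mx (x ∷ w) = classify
    (expect r λ r → rest r false mx w)
    0
    (λ b → permits p (record? mx b) * rest r (record? mx b) (mx ▹ b) w) x

  -- `mid` is fixed only if the word ends or a larger letter follows at once; that letter is a
  -- record, hence `true`.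
  afterMid : ℕ → Vec Letter L → ℕ
  afterMid r []      = δ r 0
  afterMid r (x ∷ w) = classify (λ _ → 0) 0 (λ b → rest r true (0 ▹ b) w) x

  -- A big letter before `mid` would keep `mid` from being a record.
  start : ℕ → Vec Letter L → ℕ
  start r []      = 0
  start r (x ∷ w) = classify (expect r λ r → start r w) (afterMid r w) (λ _ → 0) x

  -- Summing the automaton over repetition-free words

  record Consistent (seen : List Letter) (used : List (Fin N)) (r : ℕ) : Set where
    field
      bound  : r ≤ s
      -- `smalls` makes the small letter expected next a fresh one; `bigs` makes freshness in the
      -- word agree with freshness in its subword of big letters.
      smalls : ∀ k → small k ∈ₗ seen → toℕ k + r < s
      bigs   : ∀ b → big b ∈ₗ seen ⇔ b ∈ₗ used

  open Consistent

  small≢big : ∀ {k b} → small k ≢ big b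
  small≢big {k} {b} eq = <⇒≢ (≤-trans (Fin.toℕ<n k) (m≤m+n s (suc (toℕ b))))
    (trans (sym (toℕ-small k)) (trans (cong toℕ eq) (toℕ-big b)))

  mid≢big : ∀ {b} → mid ≢ big b
  mid≢big {b} eq = Fin.0≢1+n (Fin.↑ʳ-injective s zero (suc b) eq)

  small≢mid : ∀ {k} → small k ≢ mid
  small≢mid {k} eq = <⇒≢ (Fin.toℕ<n k) (trans (sym (toℕ-small k)) (trans (cong toℕ eq) toℕ-mid))

  small-injective : ∀ {j k} → small j ≡ small k → j ≡ k
  small-injective = Fin.↑ˡ-injective (suc N) _ _

  big-injective : ∀ {b c} → big b ≡ big c → b ≡ c
  big-injective eq = Fin.suc-injective (Fin.↑ʳ-injective s _ _ eq)

  consistent-small : ∀ {seen used r k} → Consistent seen used (suc r) → toℕ k + suc r ≡ s →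
                     Consistent (small k ∷ seen) used r
  consistent-small {r = r} c eq .bound = <⇒≤ (c .bound)
  consistent-small {r = r} {k} c eq .smalls k′ (here e) rewrite small-injective e =
    subst (toℕ k + r <_) eq (+-monoʳ-< (toℕ k) (n<1+n r))
  consistent-small {r = r} c eq .smalls k′ (there ∈seen) =
    <-trans (+-monoʳ-< (toℕ k′) (n<1+n r)) (c .smalls k′ ∈seen)
  consistent-small c eq .bigs b = mk⇔
    (λ { (here e) → ⊥-elim (small≢big (sym e)) ; (there ∈seen) → to (c .bigs b) ∈seen })
    (there ∘ from (c .bigs b))

  consistent-mid : ∀ {seen used r} → Consistent seen used r → Consistent (mid ∷ seen) used r
  consistent-mid c .bound = c .bound
  consistent-mid c .smalls k (here e)      = ⊥-elim (small≢mid e)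
  consistent-mid c .smalls k (there ∈seen) = c .smalls k ∈seen
  consistent-mid c .bigs b = mk⇔
    (λ { (here e) → ⊥-elim (mid≢big (sym e)) ; (there ∈seen) → to (c .bigs b) ∈seen })
    (there ∘ from (c .bigs b))

  consistent-big : ∀ {seen used r b} → Consistent seen used r → Consistent (big b ∷ seen) (b ∷ used) r
  consistent-big c .bound = c .bound
  consistent-big c .smalls k (here e)      = ⊥-elim (small≢big e)
  consistent-big c .smalls k (there ∈seen) = c .smalls k ∈seen
  consistent-big c .bigs b = mk⇔
    (λ { (here e) → here (big-injective e) ; (there ∈seen) → there (to (c .bigs b) ∈seen) })
    (λ { (here refl) → here refl ; (there ∈used) → there (from (c .bigs b) ∈used) })

  ind-∉-big : ∀ {seen used r} → Consistent seen used r → ∀ b →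
    ind (¬? (_∈?_ _≟_ (big b) seen)) ≡ ind (¬? (_∈?_ _≟_ b used))
  ind-∉-big {seen} {used} c b = ind-cong (¬? (_∈?_ _≟_ (big b) seen)) (¬? (_∈?_ _≟_ b used))
    (mk⇔ (_∘ from (c .bigs b)) (_∘ to (c .bigs b)))

  ∑fresh : ∀ L → List Letter → (Vec Letter L → ℕ) → ℕ
  ∑fresh L seen F = ∑words (s + suc N) L λ w → fresh seen w * F w

  -- Only the summand of the next small letter is nonzero.
  ∑fresh-small : ∀ L {seen used r} (F : ℕ → Vec Letter L → ℕ) (V : ℕ) → Consistent seen used (suc r) →
    (∀ {k} → toℕ k + suc r ≡ s → ∑fresh L (small k ∷ seen) (F r) ≡ V) →
    sum (λ k → ∑words (s + suc N) L λ w →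
          fresh seen (small k ∷ w) * expect (suc r) (λ r → F r w) k) ≡ V
  ∑fresh-small L {seen} {r = r} F V c F≡V = begin
    sum (λ k → ∑words (s + suc N) L λ w → fresh seen (small k ∷ w) * expect (suc r) (λ r → F r w) k)
      ≡⟨ sum-cong-≗ (λ k → ∑words-*-interchange (s + suc N) L
           (ind (¬? (_∈?_ _≟_ (small k) seen))) (ind (toℕ k + suc r ℕ.≟ s)) (fresh (small k ∷ seen)) (F r)) ⟩
    sum (λ k → term k)
      ≡⟨ sum-single k₀ (λ k k≢k₀ → cong (_* ∑fresh L (small k ∷ seen) (F r)) (trans
           (cong (ind (¬? (_∈?_ _≟_ (small k) seen)) *_) (ind-no (toℕ k + suc r ℕ.≟ s)
             λ eq → k≢k₀ (Fin.toℕ-injective (+-cancelʳ-≡ (suc r) (toℕ k) (toℕ k₀) (trans eq (sym k₀-next))))))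
           (*-zeroʳ (ind (¬? (_∈?_ _≟_ (small k) seen)))))) ⟩
    term k₀
      ≡⟨ cong₂ (λ a b → (a * b) * ∑fresh L (small k₀ ∷ seen) (F r))
           (ind-yes (¬? (_∈?_ _≟_ (small k₀) seen)) λ ∈seen → <-irrefl k₀-next (c .smalls k₀ ∈seen))
           (ind-yes (toℕ k₀ + suc r ℕ.≟ s) k₀-next) ⟩
    1 * ∑fresh L (small k₀ ∷ seen) (F r)
      ≡⟨ trans (*-identityˡ _) (F≡V k₀-next) ⟩
    V ∎
    where
    open ≡-Reasoning
    term : Fin s → ℕ
    term k = (ind (¬? (_∈?_ _≟_ (small k) seen)) * ind (toℕ k + suc r ℕ.≟ s)) *
             ∑fresh L (small k ∷ seen) (F r)
    s∸1+r<s : s ∸ suc r < s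
    s∸1+r<s = ∸-monoʳ-< {s} {suc r} {0} (s≤s z≤n) (c .bound)
    k₀ : Fin s
    k₀ = Fin.fromℕ< s∸1+r<s
    k₀-next : toℕ k₀ + suc r ≡ s
    k₀-next = trans (cong (_+ suc r) (Fin.toℕ-fromℕ< s∸1+r<s)) (m∸n+n≡m (c .bound))

  ∑fresh-big : ∀ L {seen used r p mx} (F : Bool → ℕ → Vec Letter L → ℕ) → Consistent seen used r → ∀ b →
    ∑words (s + suc N) L (λ w → fresh seen (big b ∷ w) *
      (permits p (record? mx b) * F (record? mx b) (mx ▹ b) w)) ≡
    (ind (¬? (_∈?_ _≟_ b used)) * permits p (record? mx b)) *
      ∑fresh L (big b ∷ seen) (F (record? mx b) (mx ▹ b))
  ∑fresh-big L {seen} {p = p} {mx} F c b = trans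
    (∑words-*-interchange (s + suc N) L (ind (¬? (_∈?_ _≟_ (big b) seen))) (permits p (record? mx b))
      (fresh (big b ∷ seen)) (F (record? mx b) (mx ▹ b)))
    (cong (λ i → (i * permits p (record? mx b)) * ∑fresh L (big b ∷ seen) (F (record? mx b) (mx ▹ b)))
          (ind-∉-big c b))

  -- Each letter lowers `r` by at most one, and only `r = 0` is accepted at the end. This removes
  -- the branches that read a big letter when only small ones fit.
  rest-short : ∀ r p mx (w : Vec Letter L) → L < r → rest r p mx w ≡ 0
  rest-short (suc r) true  mx []      _   = refl
  rest-short (suc r) false mx []      _   = refl
  rest-short (suc r) p     mx (x ∷ w) L<r with view x
  ... | isSmall k = trans (classify-small k)
    (trans (cong (ind (toℕ k + suc r ℕ.≟ s) *_) (rest-short r false mx w (≤-pred L<r)))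
           (*-zeroʳ (ind (toℕ k + suc r ℕ.≟ s))))
  ... | isMid     = classify-mid
  ... | isBig b   = trans (classify-big b)
    (trans (cong (permits p (record? mx b) *_) (rest-short (suc r) _ _ w (<⇒≤ L<r)))
           (*-zeroʳ (permits p (record? mx b))))

  ∑fresh-first : ∀ L seen (f : Vec Letter L → Fin s → ℕ) (a : Vec Letter L → ℕ) (g : Vec Letter L → Fin N → ℕ) →
    sum (λ x → ∑words (s + suc N) L λ w → fresh seen (x ∷ w) * classify (f w) (a w) (g w) x) ≡
    sum (λ k → ∑words (s + suc N) L λ w → fresh seen (small k ∷ w) * f w k) +
      (∑words (s + suc N) L (λ w → fresh seen (mid ∷ w) * a w) +
       sum (λ b → ∑words (s + suc N) L λ w → fresh seen (big b ∷ w) * g w b))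
  ∑fresh-first L seen f a g = trans
    (sum-letters λ x → ∑words (s + suc N) L λ w → fresh seen (x ∷ w) * classify (f w) (a w) (g w) x)
    (cong₂ _+_
      (sum-cong-≗ λ k → ∑words-cong (s + suc N) L λ w → cong (fresh seen (small k ∷ w) *_) (classify-small k))
      (cong₂ _+_
        (∑words-cong (s + suc N) L λ w → cong (fresh seen (mid ∷ w) *_) classify-mid)
        (sum-cong-≗ λ b → ∑words-cong (s + suc N) L λ w → cong (fresh seen (big b ∷ w) *_) (classify-big b))))

  ∑fresh-*0 : ∀ L seen x → ∑words (s + suc N) L (λ w → fresh seen (x ∷ w) * 0) ≡ 0
  ∑fresh-*0 L seen x = ∑words-zero (s + suc N) L λ w → *-zeroʳ (fresh seen (x ∷ w))

  zero-+ : ∀ {a b} → a ≡ 0 → a + b ≡ b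
  zero-+ refl = refl

  +-zero : ∀ {a b} → b ≡ 0 → a + b ≡ a
  +-zero {a} refl = +-identityʳ a

  module _ (seen : List Letter) (r : ℕ) (p : Bool) (mx : ℕ) where

    restBig : ∀ L → Fin N → Vec Letter L → ℕ
    restBig L b w = permits p (record? mx b) * rest r (record? mx b) (mx ▹ b) w

    ∑restBig : ℕ → ℕ
    ∑restBig L = sum λ b → ∑words (s + suc N) L λ w → fresh seen (big b ∷ w) * restBig L b w

    ∑fresh-rest-first : ∀ L → ∑fresh (suc L) seen (rest r p mx) ≡
      sum (λ k → ∑words (s + suc N) L λ w → fresh seen (small k ∷ w) * expect r (λ r → rest r false mx w) k) +
        ∑restBig L
    ∑fresh-rest-first L = trans
      (∑fresh-first L seen (λ w → expect r λ r → rest r false mx w) (λ _ → 0) (λ w b → restBig L b w))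
      (cong (sum (λ k → ∑words (s + suc N) L λ w →
               fresh seen (small k ∷ w) * expect r (λ r → rest r false mx w) k) +_)
            (zero-+ (∑fresh-*0 L seen mid)))

    ∑restBig-short : ∀ L → L < r → ∑restBig L ≡ 0
    ∑restBig-short L L<r = sum-zero λ b → ∑words-zero (s + suc N) L λ w → trans
      (cong (fresh seen (big b ∷ w) *_) (trans
        (cong (permits p (record? mx b) *_) (rest-short r (record? mx b) (mx ▹ b) w L<r))
        (*-zeroʳ (permits p (record? mx b)))))
      (*-zeroʳ (fresh seen (big b ∷ w)))

  module _ (used : List (Fin N)) (p : Bool) (mx : ℕ) where

    ∑shufflesBig : ℕ → ℕ → ℕ
    ∑shufflesBig r L = sum λ b → ∑words N L λ u →
      fresh used (b ∷ u) * (permits p (record? mx b) * shuffles (record? mx b) (mx ▹ b) u r)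

    ∑shuffles-suc : ∀ r L →
      ∑words N (suc L) (λ u → fresh used u * shuffles false mx u r) + ∑shufflesBig (suc r) L ≡
      ∑words N (suc L) (λ u → fresh used u * shuffles p mx u (suc r))
    ∑shuffles-suc r L = trans (sym (∑-distrib-+ {N} _ _)) (sum-cong-≗ λ b → trans
      (sym (∑words-+ N L (λ u → fresh used (b ∷ u) * shuffles false mx (b ∷ u) r) _))
      (∑words-cong N L λ u → sym (*-distribˡ-+ (fresh used (b ∷ u)) (shuffles false mx (b ∷ u) r) _)))

  -- Deleting the small letters of an accepted word leaves a word `u` of `L` big letters, and
  -- `shuffles` counts the words that come from `u`. Both sides obey the same recursion on the first
  -- letter.
  ∑fresh-rest : ∀ r L {seen used} p mx → Consistent seen used r →
    ∑fresh (r + L) seen (rest r p mx) ≡ ∑words N L (λ u → fresh used u * shuffles p mx u r)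

  ∑restBig≡∑shufflesBig : ∀ r L {seen used} p mx → Consistent seen used r →
    ∑restBig seen r p mx (r + L) ≡ ∑shufflesBig used p mx r L
  ∑restBig≡∑shufflesBig r L {seen} {used} p mx c = sum-cong-≗ λ b → trans
    (∑fresh-big (r + L) {p = p} {mx} (λ q m → rest r q m) c b)
    (trans (cong ((ind (¬? (_∈?_ _≟_ b used)) * permits p (record? mx b)) *_)
                 (∑fresh-rest r L (record? mx b) (mx ▹ b) (consistent-big c)))
           (sym (∑words-*-interchange N L (ind (¬? (_∈?_ _≟_ b used))) (permits p (record? mx b))
                   (fresh (b ∷ used)) (λ u → shuffles (record? mx b) (mx ▹ b) u r))))

  ∑fresh-rest zero    zero    p mx c = refl
  ∑fresh-rest zero    (suc L) {seen} p mx c = trans (∑fresh-rest-first seen 0 p mx L)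
    (trans (zero-+ (sum-zero λ k → ∑fresh-*0 L seen (small k))) (∑restBig≡∑shufflesBig 0 L p mx c))
  -- No big letter is due: reading one would leave only `r` places for `suc r` small letters.
  ∑fresh-rest (suc r) zero    {seen} p mx c = trans (∑fresh-rest-first seen (suc r) p mx (r + 0))
    (trans (+-zero (∑restBig-short seen (suc r) p mx (r + 0) (s≤s (≤-reflexive (+-identityʳ r)))))
           (∑fresh-small (r + 0) (λ r → rest r false mx) _ c λ eq →
              ∑fresh-rest r 0 false mx (consistent-small c eq)))
  ∑fresh-rest (suc r) (suc L) {seen} {used} p mx c = trans (∑fresh-rest-first seen (suc r) p mx (r + suc L))
    (trans (cong₂ _+_
      (∑fresh-small (r + suc L) (λ r → rest r false mx) _ c λ eq →
        ∑fresh-rest r (suc L) false mx (consistent-small c eq))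
      (trans (cong (∑restBig seen (suc r) p mx) (+-suc r L)) (∑restBig≡∑shufflesBig (suc r) L p mx c)))
    (∑shuffles-suc used p mx r L))

  -- Every big letter is a record over the bound 0, so reading it from `afterMid` amounts to reading
  -- it from `rest` with `p` false.
  ∑fresh-afterMid-first : ∀ r L seen → ∑fresh (suc L) seen (afterMid r) ≡ ∑restBig seen r false 0 L
  ∑fresh-afterMid-first r L seen = trans
    (∑fresh-first L seen (λ _ _ → 0) (λ _ → 0) (λ w b → rest r true (0 ▹ b) w))
    (trans (zero-+ (sum-zero λ k → ∑fresh-*0 L seen (small k)))
    (trans (zero-+ (∑fresh-*0 L seen mid))
           (sum-cong-≗ λ b → ∑words-cong (s + suc N) L λ w →
              cong (fresh seen (big b ∷ w) *_) (sym (*-identityˡ (rest r true (0 ▹ b) w))))))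

  ∑fresh-afterMid : ∀ r L {seen used} → Consistent seen used r →
    ∑fresh (r + suc L) seen (afterMid r) ≡ ∑shufflesBig used false 0 r L
  ∑fresh-afterMid r L {seen} c rewrite +-suc r L =
    trans (∑fresh-afterMid-first r (r + L) seen) (∑restBig≡∑shufflesBig r L false 0 c)

  ∑fresh-start-first : ∀ r L seen → mid ∉ₗ seen → ∑fresh (suc L) seen (start r) ≡
    sum (λ k → ∑words (s + suc N) L λ w → fresh seen (small k ∷ w) * expect r (λ r → start r w) k) +
      ∑fresh L (mid ∷ seen) (afterMid r)
  ∑fresh-start-first r L seen mid∉ = trans
    (∑fresh-first L seen (λ w → expect r λ r → start r w) (afterMid r) (λ _ _ → 0))
    (cong (sum (λ k → ∑words (s + suc N) L λ w → fresh seen (small k ∷ w) * expect r (λ r → start r w) k) +_)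
          (trans (+-zero (sum-zero λ b → ∑fresh-*0 L seen (big b)))
                 (∑words-cong (s + suc N) L λ w → cong (_* afterMid r w)
                   (trans (cong (_* fresh (mid ∷ seen) w) (ind-yes (¬? (_∈?_ _≟_ mid seen)) mid∉))
                          (*-identityˡ _)))))

  -- The front gap of `shuffles` lies before `mid`: the first big letter must follow `mid` directly,
  -- so the two behave as one letter. The extra 1 in the length is `mid`.
  ∑fresh-start : ∀ r L {seen used} → mid ∉ₗ seen → Consistent seen used r →
    ∑fresh (suc (r + L)) seen (start r) ≡ ∑words N L (λ u → fresh used u * shuffles false 0 u r)
  ∑fresh-start zero L {seen} {used} mid∉ c = trans (∑fresh-start-first 0 L seen mid∉)
    (trans (zero-+ (sum-zero λ k → ∑fresh-*0 L seen (small k))) (final L))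
    where
    final : ∀ L → ∑fresh L (mid ∷ seen) (afterMid 0) ≡ ∑words N L (λ u → fresh used u * shuffles false 0 u 0)
    final zero    = refl
    final (suc L) = ∑fresh-afterMid 0 L (consistent-mid c)
  ∑fresh-start (suc r) L {seen} {used} mid∉ c = trans (∑fresh-start-first (suc r) (suc r + L) seen mid∉)
    (trans (cong (_+ ∑fresh (suc r + L) (mid ∷ seen) (afterMid (suc r)))
                 (∑fresh-small (suc r + L) (λ r → start r) _ c λ {k} eq → ∑fresh-start r L
                   (λ { (here e) → small≢mid (sym e) ; (there ∈seen) → mid∉ ∈seen }) (consistent-small c eq)))
           (final L))
    where
    final : ∀ L → ∑words N L (λ u → fresh used u * shuffles false 0 u r) +
                    ∑fresh (suc r + L) (mid ∷ seen) (afterMid (suc r)) ≡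
                  ∑words N L (λ u → fresh used u * shuffles false 0 u (suc r))
    final zero    = +-zero (trans (∑fresh-afterMid-first (suc r) (r + 0) (mid ∷ seen))
      (∑restBig-short (mid ∷ seen) (suc r) false 0 (r + 0) (s≤s (≤-reflexive (+-identityʳ r)))))
    final (suc L) = trans
      (cong (∑words N (suc L) (λ u → fresh used u * shuffles false 0 u r) +_)
            (∑fresh-afterMid (suc r) L (consistent-mid c)))
      (∑shuffles-suc used false 0 r L)

  ∑perms-start : ∑perms (s + suc N) (start s) ≡ ∑perms N (λ u → (s + hatNonfixed 0 u) C N)
  ∑perms-start = trans (reindex (+-suc s N))
    (trans (∑fresh-start s N {[]} {[]} (λ ())
              record { bound = ≤-refl ; smalls = λ _ () ; bigs = λ _ → mk⇔ (λ ()) λ () })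
           (∑words-cong N N λ u → cong₂ _*_ (fresh-unique u) (shuffles-C 0 u s)))
    where
    -- Only the length is rewritten; the alphabet keeps its size `s + suc N`.
    reindex : ∀ {M} → M ≡ suc (s + N) → ∑words (s + suc N) M (λ w → ind (unique? w) * start s w) ≡
                                        ∑fresh (suc (s + N)) [] (start s)
    reindex refl = ∑words-cong (s + suc N) (suc (s + N)) λ w → cong (_* start s w) (sym (fresh-unique w))

-- The fixed points of hat π

HatFixed : ℕ → Vec (Fin n) L → Fin n → Set
HatFixed mx []      y = ⊥
HatFixed mx (x ∷ w) y =
  (y ≡ x × record? mx x ≡ true × closed? (mx ▹ x) w ≡ true) ⊎ HatFixed (mx ▹ x) w y

hatFixed? : ∀ mx (w : Vec (Fin n) L) y → Dec (HatFixed mx w y)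
hatFixed? mx []      y = no λ ()
hatFixed? mx (x ∷ w) y =
  ((y ≟ x) ×-dec (record? mx x Bool.≟ true) ×-dec (closed? (mx ▹ x) w Bool.≟ true))
    ⊎-dec hatFixed? (mx ▹ x) w y

record?⇔≤ : ∀ {mx} {x : Fin n} → record? mx x ≡ true ⇔ mx ≤ toℕ x
record?⇔≤ {mx = mx} {x} = mk⇔ (≤ᵇ⇒≤ mx (toℕ x) ∘ from T-≡) (to T-≡ ∘ ≤⇒≤ᵇ)

hatFixed⇒≤ : ∀ mx (w : Vec (Fin n) L) {y} → HatFixed mx w y → mx ≤ toℕ y
hatFixed⇒≤ mx (x ∷ w) (inj₁ (refl , rec , _)) = to record?⇔≤ rec
hatFixed⇒≤ mx (x ∷ w) (inj₂ fix) = ≤-trans (m≤m⊔n mx (suc (toℕ x))) (hatFixed⇒≤ (mx ▹ x) w fix)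

hatNonfixed≡length : ∀ mx (w : Vec (Fin n) L) → (∀ y → ¬ HatFixed mx w y) ⇔ (hatNonfixed mx w ≡ L)
hatNonfixed≡length mx w = mk⇔ (to′ mx w) (from′ mx w)
  where
  to′ : ∀ {L} mx (w : Vec (Fin _) L) → (∀ y → ¬ HatFixed mx w y) → hatNonfixed mx w ≡ L
  to′ mx []      _   = refl
  to′ mx (x ∷ w) ¬fix with record? mx x | closed? (mx ▹ x) w
  ... | true  | true  = ⊥-elim (¬fix x (inj₁ (refl , refl , refl)))
  ... | true  | false = cong suc (to′ (mx ▹ x) w λ y → ¬fix y ∘ inj₂)
  ... | false | _     = cong suc (to′ (mx ▹ x) w λ y → ¬fix y ∘ inj₂)
  from′ : ∀ {L} mx (w : Vec (Fin _) L) → hatNonfixed mx w ≡ L → ∀ y → ¬ HatFixed mx w y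
  from′ mx (x ∷ w) eq y (inj₁ (_ , rec , cl)) rewrite rec | cl =
    <-irrefl refl (subst (_≤ _) eq (hatNonfixed≤ (mx ▹ x) w))
  from′ mx (x ∷ w) eq y (inj₂ fix) with record? mx x ∧ closed? (mx ▹ x) w
  ... | true  = <-irrefl refl (subst (_≤ _) eq (hatNonfixed≤ (mx ▹ x) w))
  ... | false = from′ (mx ▹ x) w (suc-injective eq) y fix

-- Correctness of the cycle form

Bounds : ℕ → List (Fin n) → Set
Bounds {n} mx left = ∀ (x : Fin n) → ListAll.All (Fin._< x) left ⇔ record? mx x ≡ true

bounds-∷ : ∀ {mx} {left : List (Fin n)} y → Bounds mx left → Bounds (mx ▹ y) (y ∷ left)
bounds-∷ {mx = mx} y bounds x = mk⇔
  (λ { (y<x ∷ all) → from (record?⇔≤ {mx = mx ▹ y}) (⊔-lub (to (record?⇔≤ {mx = mx}) (to (bounds x) all)) y<x) })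
  (λ rec → let mx▹y≤x = to (record?⇔≤ {mx = mx ▹ y}) rec in
    ≤-trans (m≤n⊔m mx (suc (toℕ y))) mx▹y≤x ∷
    from (bounds x) (from (record?⇔≤ {mx = mx}) (≤-trans (m≤m⊔n mx (suc (toℕ y))) mx▹y≤x)))

-- `cut` carries the induction: a record standing before `w` forms a cycle of its own exactly when
-- the first piece is empty.
record SplitCorrect (mx : ℕ) (w : Vec (Fin n) L) (split : List (Fin n) × List (List (Fin n))) : Set where
  field
    joined     : toList w ≡ proj₁ split ++ List.concat (proj₂ split)
    cut        : proj₁ split ≡ [] ⇔ closed? mx w ≡ true
    singletons : ∀ y → (y ∷ []) ∈ₗ proj₂ split ⇔ HatFixed mx w y

open SplitCorrect

splitCycles-correct : ∀ {mx} {left : List (Fin n)} (w : Vec (Fin n) L) → Bounds mx left →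
                      SplitCorrect mx w (splitCycles left (toList w))
splitCycles-correct [] bounds = record
  { joined     = refl
  ; cut        = mk⇔ (λ _ → refl) (λ _ → refl)
  ; singletons = λ y → mk⇔ (λ ()) λ ()
  }
splitCycles-correct {mx = mx} {left} (x ∷ w) bounds
  with ListAll.all? (Fin._<? x) left | splitCycles (x ∷ left) (toList w)
     | splitCycles-correct w (bounds-∷ {mx = mx} x bounds)
... | yes all | c , cs | ih = record
  { joined     = cong (x ∷_) (ih .joined)
  ; cut        = mk⇔ (λ _ → to (bounds x) all) (λ _ → refl)
  ; singletons = λ y → mk⇔
      (λ { (here eq) → inj₁ (List.∷-injectiveˡ eq , to (bounds x) all ,
                             to (ih .cut) (sym (List.∷-injectiveʳ eq)))
         ; (there ∈cs) → inj₂ (to (ih .singletons y) ∈cs) })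
      (λ { (inj₁ (refl , _ , cl)) → here (cong (x ∷_) (sym (from (ih .cut) cl)))
         ; (inj₂ fix) → there (from (ih .singletons y) fix) })
  }
... | no ¬all | c , cs | ih = record
  { joined     = cong (x ∷_) (ih .joined)
  ; cut        = mk⇔ (λ ()) (λ rec → ⊥-elim (¬all (from (bounds x) rec)))
  ; singletons = λ y → mk⇔ (inj₂ ∘ to (ih .singletons y))
      (λ { (inj₁ (_ , rec , _)) → ⊥-elim (¬all (from (bounds x) rec))
         ; (inj₂ fix) → from (ih .singletons y) fix })
  }

unique-++⁻ : (xs {ys} : List (Fin n)) → List.Unique (xs ++ ys) →
             List.Unique xs × List.Unique ys × (∀ {x} → x ∈ₗ xs → x ∉ₗ ys)
unique-++⁻ []       uys        = [] , uys , λ ()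
unique-++⁻ (x ∷ xs) (x∉ ∷ uxs) with unique-++⁻ xs uxs
... | uxs′ , uys , disjoint = (ListAll.++⁻ˡ xs x∉ ∷ uxs′) , uys ,
  λ { (here refl) x∈ys → ListAll.lookup (ListAll.++⁻ʳ xs x∉) x∈ys refl ; (there x∈xs) → disjoint x∈xs }

-- A letter other than the last goes to its right neighbour, which is different; the last goes to
-- `c`, excluded by `x ≢ c`.
next-moves : ∀ {c a x : Fin n} (w : List (Fin n)) → List.Unique (a ∷ w) → x ∈ₗ (a ∷ w) → x ≢ c → next c a w x ≢ x
next-moves []      _          _   x≢c eq = x≢c (sym eq)
next-moves {a = a} {x} (b ∷ w) ((a≢b ∷ _) ∷ uw) x∈ x≢c eq with a ≟ x
... | yes refl = a≢b (sym eq)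
next-moves (b ∷ w) (_ ∷ uw) (here x≡a)  x≢c eq | no a≢x = a≢x (sym x≡a)
next-moves (b ∷ w) (_ ∷ uw) (there x∈w) x≢c eq | no a≢x = next-moves w uw x∈w x≢c eq

applyCycles-fixed : (cs : List (List (Fin n))) → List.Unique (List.concat cs) → ∀ {x} → x ∈ₗ List.concat cs →
                    applyCycles cs x ≡ x ⇔ (x ∷ []) ∈ₗ cs
applyCycles-fixed ([] ∷ cs)      ucs x∈ = mk⇔ (there ∘ to (applyCycles-fixed cs ucs x∈))
  λ { (there ∈cs) → from (applyCycles-fixed cs ucs x∈) ∈cs }
applyCycles-fixed ((c ∷ w) ∷ cs) ucs {x} x∈ with unique-++⁻ (c ∷ w) ucs | _∈?_ _≟_ x (c ∷ w)
... | ucw , _ , disjoint | yes x∈cw = mk⇔ (to′ w ucw x∈cw)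
  λ { (here refl)  → refl
    ; (there x∈cs) → ⊥-elim (disjoint x∈cw (List.∈-concat⁺′ (here refl) x∈cs)) }
  where
  to′ : ∀ {x} w → List.Unique (c ∷ w) → x ∈ₗ (c ∷ w) → next c c w x ≡ x → (x ∷ []) ∈ₗ ((c ∷ w) ∷ cs)
  to′ {x} []      _   (here refl) _  = here refl
  to′ {x} (b ∷ w) ucw@((c≢b ∷ _) ∷ _) x∈ eq with x ≟ c
  ... | no x≢c = ⊥-elim (next-moves (b ∷ w) ucw x∈ x≢c eq)
  ... | yes refl with x ≟ x
  ...   | yes _  = ⊥-elim (c≢b (sym eq))
  ...   | no x≢x = ⊥-elim (x≢x refl)
... | _ , ucs′ , _ | no x∉cw = mk⇔
  (there ∘ to (applyCycles-fixed cs ucs′ x∈cs))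
  λ { (here refl)  → ⊥-elim (x∉cw (here refl))
    ; (there ∈cs) → from (applyCycles-fixed cs ucs′ x∈cs) ∈cs }
  where
  x∈cs = [ ⊥-elim ∘ x∉cw , (λ x∈cs → x∈cs) ]′ (List.∈-++⁻ (c ∷ w) x∈)

hat-fixed : {π : Vec (Fin n) n} → Unique π → ∀ y → hat π y ≡ y ⇔ HatFixed 0 π y
hat-fixed {n} {π} uπ y = mk⇔
  (to (correct .singletons y) ∘ to fixed) (from fixed ∘ from (correct .singletons y))
  where
  correct : SplitCorrect 0 π (splitCycles [] (toList π))
  correct = splitCycles-correct {mx = 0} π (λ x → mk⇔ (λ _ → refl) (λ _ → []))
  closed?-0 : ∀ {L} (w : Vec (Fin n) L) → closed? 0 w ≡ true
  closed?-0 []      = refl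
  closed?-0 (_ ∷ _) = refl
  -- `cycleForm` drops the first piece, which is empty because every word is closed under the bound
  -- 0, so no letter is lost.
  letters : toList π ≡ List.concat (cycleForm π)
  letters = trans (correct .joined)
    (cong (_++ List.concat (cycleForm π)) (from (correct .cut) (closed?-0 π)))
  fixed : hat π y ≡ y ⇔ (y ∷ []) ∈ₗ cycleForm π
  fixed = applyCycles-fixed (cycleForm π) (subst List.Unique letters (to unique-toList uπ))
    (subst (y ∈ₗ_) letters (∈-toList⁺ (unique-complete uπ y)))

-- Avoidance in terms of the largest fixed point

Ordered : Fin n → Vec (Fin n) L → Set
Ordered c = AllPairs λ x y → x Fin.< c → ¬ (y Fin.< x)

TopFixed : Fin n → Vec (Fin n) n → Set
TopFixed c π = HatFixed 0 π c × (∀ y → c Fin.< y → ¬ HatFixed 0 π y) × Ordered c π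

topFixed? : ∀ c (π : Vec (Fin n) n) → Dec (TopFixed c π)
topFixed? c π =
  hatFixed? 0 π c ×-dec
  Fin.all? (λ y → (c Fin.<? y) →-dec ¬? (hatFixed? 0 π y)) ×-dec
  allPairs? (λ x y → (x Fin.<? c) →-dec ¬? (y Fin.<? x)) π

-- Makes the sum of `ind (topFixed? c π)` over all `c` an indicator.
topFixed-unique : {π : Vec (Fin n) n} → ∀ {c d} → TopFixed c π → TopFixed d π → c ≡ d
topFixed-unique {c = c} {d} (fc , ¬>c , _) (fd , ¬>d , _) with Fin.<-cmp c d
... | tri< c<d _ _ = ⊥-elim (¬>c d c<d fd)
... | tri≈ _ c≡d _ = c≡d
... | tri> _ _ d<c = ⊥-elim (¬>d c d<c fc)

none⊎largest : {P : Fin n → Set} → Decidable P →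
               (∀ y → ¬ P y) ⊎ (∃[ c ] P c × (∀ y → c Fin.< y → ¬ P y))
none⊎largest {zero}  P? = inj₁ λ ()
none⊎largest {suc n} P? with none⊎largest (P? ∘ suc)
... | inj₂ (c , pc , ¬>c) = inj₂ (suc c , pc , λ { (suc y) c<y → ¬>c y (≤-pred c<y) })
... | inj₁ none with P? zero
...   | yes p0 = inj₂ (zero , p0 , λ { (suc y) _ → none y })
...   | no ¬p0 = inj₁ λ { zero → ¬p0 ; (suc y) → none y }

allPairs-lookup : {R : Fin n → Fin n → Set} (w : Vec (Fin n) L) →
  AllPairs R w ⇔ (∀ i j → i Fin.< j → R (lookup w i) (lookup w j))
allPairs-lookup w = mk⇔ to′ (from′ w)
  where
  to′ : ∀ {L} {R : Fin _ → Fin _ → Set} {w : Vec (Fin _) L} → AllPairs R w →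
        ∀ i j → i Fin.< j → R (lookup w i) (lookup w j)
  to′ (r ∷ _)  zero    (suc j) _   = All.lookup⁺ r j
  to′ (_ ∷ rs) (suc i) (suc j) i<j = to′ rs i j (≤-pred i<j)
  from′ : ∀ {L} {R : Fin _ → Fin _ → Set} (w : Vec (Fin _) L) →
          (∀ i j → i Fin.< j → R (lookup w i) (lookup w j)) → AllPairs R w
  from′ []      _ = []
  from′ (x ∷ w) f = All.lookup⁻ (λ j → f zero (suc j) (s≤s z≤n)) ∷ from′ w λ i j i<j → f (suc i) (suc j) (s≤s i<j)

-- A 21 below some fixed point lies below the largest one; conversely the largest one serves as the
-- 3 of the pattern.
avoids⇔ : {π : Vec (Fin n) n} → Unique π →
          ((∀ y → ¬ HatFixed 0 π y) ⊎ (∃[ c ] TopFixed c π)) ⇔ Avoids ⟨21⨾3→3⟩ π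
avoids⇔ {n} {π} uπ = mk⇔ to′ from′
  where
  to′ : (∀ y → ¬ HatFixed 0 π y) ⊎ (∃[ c ] TopFixed c π) → Avoids ⟨21⨾3→3⟩ π
  to′ (inj₁ none) ((_ ∷ _ ∷ x₂ ∷ []) , _ , _ , _ , _ , fix ∷ []) = none x₂ (to (hat-fixed uπ x₂) fix)
  to′ (inj₂ (c , _ , ¬>c , ordered))
      ((x₀ ∷ x₁ ∷ x₂ ∷ []) , ((x₀<x₁ ∷ _) ∷ (x₁<x₂ ∷ []) ∷ _) ,
       (t₀ ∷ t₁ ∷ []) , ((t₀<t₁ ∷ []) ∷ _) , eq , fix ∷ [])
    with ∷-injective eq
  ... | πt₀≡x₁ , eq′ with ∷-injective eq′
  ...   | πt₁≡x₀ , _ = to (allPairs-lookup π) ordered t₀ t₁ t₀<t₁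
    (subst (Fin._< c) (sym πt₀≡x₁) (<-≤-trans x₁<x₂ x₂≤c))
    (subst₂ Fin._<_ (sym πt₁≡x₀) (sym πt₀≡x₁) x₀<x₁)
    where
    x₂≤c : toℕ x₂ ≤ toℕ c
    x₂≤c = ≮⇒≥ λ c<x₂ → ¬>c x₂ c<x₂ (to (hat-fixed uπ x₂) fix)
  from′ : Avoids ⟨21⨾3→3⟩ π → (∀ y → ¬ HatFixed 0 π y) ⊎ (∃[ c ] TopFixed c π)
  from′ avoids with none⊎largest (hatFixed? 0 π)
  ... | inj₁ none = inj₁ none
  ... | inj₂ (c , fc , ¬>c) = inj₂ (c , fc , ¬>c , from (allPairs-lookup π) λ i j i<j πi<c πj<πi → avoids
    ( (lookup π j ∷ lookup π i ∷ c ∷ []) , ((πj<πi ∷ <-trans πj<πi πi<c ∷ []) ∷ (πi<c ∷ []) ∷ [] ∷ [])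
    , (i ∷ j ∷ []) , ((i<j ∷ []) ∷ [] ∷ []) , refl , from (hat-fixed uπ c) fc ∷ []))

-- The automaton recognises the permutations with top fixed point mid

-- Needed because the invariant of the tail is available only if the small letter just read is the
-- expected one.
indicator-×-dep : ∀ {a b} → Indicator P a → (P → Indicator Q b) → Indicator (P × Q) (a * b)
indicator-×-dep (one p)   q = indicator-× (one p) (q p)
indicator-×-dep (zero ¬p) _ = zero (¬p ∘ proj₁)

permits-indicator : ∀ p q → Indicator (p ≡ true → q ≡ false) (permits p q)
permits-indicator true  true  = zero λ f → case f refl of λ ()
permits-indicator true  false = one λ _ → refl
permits-indicator false q     = one λ ()

≤ᵇ-+ : ∀ s a b → (s + a ≤ᵇ s + b) ≡ (a ≤ᵇ b)
≤ᵇ-+ zero    a b = refl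
≤ᵇ-+ (suc s) a b = trans (≤ᵇ-suc (s + a) (s + b)) (≤ᵇ-+ s a b)
  where
  ≤ᵇ-suc : ∀ a b → (suc a ≤ᵇ suc b) ≡ (a ≤ᵇ b)
  ≤ᵇ-suc zero    b = refl
  ≤ᵇ-suc (suc a) b = refl

≰⇒¬record? : ∀ {mx} {x : Fin n} → toℕ x < mx → record? mx x ≡ false
≰⇒¬record? {mx = mx} {x} x<mx with record? mx x in rec
... | true  = ⊥-elim (<⇒≱ x<mx (to (record?⇔≤ {mx = mx} {x}) rec))
... | false = refl

module _ (s N : ℕ) where
  open Automaton s N

  small<mid : ∀ k → small k Fin.< mid
  small<mid k = subst₂ _<_ (sym (toℕ-small k)) (sym toℕ-mid) (Fin.toℕ<n k)

  mid<big : ∀ b → mid Fin.< big b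
  mid<big b = subst₂ _<_ (sym toℕ-mid) (sym (toℕ-big b)) (m<m+n s (s≤s z≤n))

  small-<⁻ : ∀ {j k} → small j Fin.< small k → toℕ j < toℕ k
  small-<⁻ {j} {k} = subst₂ _<_ (toℕ-small j) (toℕ-small k)

  small-<⁺ : ∀ {j k} → toℕ j < toℕ k → small j Fin.< small k
  small-<⁺ {j} {k} = subst₂ _<_ (sym (toℕ-small j)) (sym (toℕ-small k))

  -- The counterpart of `Consistent` for the suffix still to be read, since `Ordered` speaks of
  -- letters to come: its small letters are exactly the `r` largest.
  record Unread (r : ℕ) (w : Vec Letter L) : Set where
    field
      r≤s    : r ≤ s
      unique : Unique w
      smalls : ∀ k → small k ∈ w ⇔ s ≤ toℕ k + r

  open Unread

  next-small : ∀ {r} → suc r ≤ s → ∃[ k ] toℕ k + suc r ≡ s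
  next-small {r} r<s = Fin.fromℕ< lt , trans (cong (_+ suc r) (Fin.toℕ-fromℕ< lt)) (m∸n+n≡m r<s)
    where
    lt : s ∸ suc r < s
    lt = ∸-monoʳ-< {s} {suc r} {0} (s≤s z≤n) r<s

  unread-[] : ∀ {r} → Unread r [] → r ≡ 0
  unread-[] {zero}  u = refl
  unread-[] {suc r} u with next-small (u .r≤s)
  ... | k , eq = case from (u .smalls k) (≤-reflexive (sym eq)) of λ ()

  unread-small-zero : ∀ {k} {w : Vec Letter L} → ¬ Unread 0 (small k ∷ w)
  unread-small-zero {k = k} u =
    <⇒≱ (Fin.toℕ<n k) (subst (s ≤_) (+-identityʳ _) (to (u .smalls k) (here refl)))

  unread-small : ∀ {r k} {w : Vec Letter L} → toℕ k + suc r ≡ s → Unread (suc r) (small k ∷ w) → Unread r w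
  unread-small eq u .r≤s = <⇒≤ (u .r≤s)
  unread-small eq u .unique with u .unique
  ... | _ ∷ uw = uw
  unread-small {r = r} {k} {w} eq u .smalls j = mk⇔ to′ from′
    where
    to′ : small j ∈ w → s ≤ toℕ j + r
    to′ j∈w = ≤-pred (subst (s <_) (+-suc (toℕ j) r)
      (≤∧≢⇒< (to (u .smalls j) (there j∈w)) λ s≡ → j≢k (+-cancelʳ-≡ (suc r) _ _ (trans (sym s≡) (sym eq)))))
      where
      j≢k : toℕ j ≢ toℕ k
      j≢k j≡k with u .unique
      ... | k∉w ∷ _ = All-≢⇒∉ k∉w (subst (λ i → small i ∈ w) (Fin.toℕ-injective j≡k) j∈w)
    from′ : s ≤ toℕ j + r → small j ∈ w
    from′ s≤j+r with from (u .smalls j) (≤-trans s≤j+r (+-monoʳ-≤ (toℕ j) (n≤1+n r)))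
    ... | there j∈w = j∈w
    ... | here e rewrite small-injective e =
      ⊥-elim (<⇒≱ (subst (toℕ k + r <_) eq (+-monoʳ-< (toℕ k) (n<1+n r))) s≤j+r)

  unread-skip : ∀ {r x} {w : Vec Letter L} → (∀ k → small k ≢ x) → Unread r (x ∷ w) → Unread r w
  unread-skip ≢x u .r≤s = u .r≤s
  unread-skip ≢x u .unique with u .unique
  ... | _ ∷ uw = uw
  unread-skip ≢x u .smalls k = mk⇔ (to (u .smalls k) ∘ there)
    λ s≤ → case from (u .smalls k) s≤ of λ { (here e) → ⊥-elim (≢x k e) ; (there k∈w) → k∈w }

  -- The least unread small letter occurs in the word, so an ordered word has to
  -- read it first.
  ordered-small : ∀ {r k} {w : Vec Letter L} → Unread (suc r) (small k ∷ w) →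
                  Ordered mid (small k ∷ w) ⇔ (toℕ k + suc r ≡ s × Ordered mid w)
  ordered-small {r = r} {k} {w} u = mk⇔ to′ from′
    where
    to′ : Ordered mid (small k ∷ w) → toℕ k + suc r ≡ s × Ordered mid w
    to′ (k≮ ∷ ordered) = least (next-small (u .r≤s)) , ordered
      where
      least : ∃[ j ] toℕ j + suc r ≡ s → toℕ k + suc r ≡ s
      least (j , eq) with from (u .smalls j) (≤-reflexive (sym eq))
      ... | here e    rewrite small-injective e = eq
      ... | there j∈w = ≤-antisym
        (≤-trans (+-monoˡ-≤ (suc r) (≮⇒≥ λ j<k → All.lookup k≮ j∈w (small<mid k) (small-<⁺ j<k))) (≤-reflexive eq))
        (to (u .smalls k) (here refl))
    from′ : toℕ k + suc r ≡ s × Ordered mid w → Ordered mid (small k ∷ w)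
    from′ (eq , ordered) = All.lookup⁻ (λ i _ → least (lookup w i) (∈-lookup i w)) ∷ ordered
      where
      least : ∀ y → y ∈ w → ¬ (y Fin.< small k)
      least y y∈w y<k with view y
      ... | isSmall j = <⇒≱ (subst (toℕ j + suc r <_) eq (+-monoˡ-< (suc r) (small-<⁻ y<k)))
                            (to (u .smalls j) (there y∈w))
      ... | isMid     = <-asym y<k (small<mid k)
      ... | isBig b   = <-asym y<k (<-trans (small<mid k) (mid<big b))

  ordered-skip : ∀ {x} {w : Vec Letter L} → ¬ (x Fin.< mid) → Ordered mid w → Ordered mid (x ∷ w)
  ordered-skip {w = w} x≮ ordered = All.universal (λ _ x< → ⊥-elim (x≮ x<)) w ∷ ordered

  -- `big b` has value `s + suc (toℕ b)`, so a bound `mx` within `Fin N` becomes `s + suc mx`; for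
  -- `mx = 0` this is the bound left by `mid`.
  record?-big : ∀ mx b → record? (s + suc mx) (big b) ≡ record? mx b
  record?-big mx b = trans (cong (s + suc mx ≤ᵇ_) (toℕ-big b))
    (trans (≤ᵇ-+ s (suc mx) (suc (toℕ b))) (record?-suc mx b))

  ▹-big : ∀ mx b → (s + suc mx) ▹ big b ≡ s + suc (mx ▹ b)
  ▹-big mx b rewrite toℕ-big b | sym (+-suc s (suc (toℕ b))) =
    sym (+-distribˡ-⊔ s (suc mx) (suc (suc (toℕ b))))

  ▹-small : ∀ mx k → (s + suc mx) ▹ small k ≡ s + suc mx
  ▹-small mx k = m≥n⇒m⊔n≡m (≤-trans (subst (_≤ s) (cong suc (sym (toℕ-small k))) (Fin.toℕ<n k)) (m≤m+n s (suc mx)))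

  record?-small : ∀ mx k → record? (s + suc mx) (small k) ≡ false
  record?-small mx k = ≰⇒¬record? (subst (_< s + suc mx) (sym (toℕ-small k)) (≤-trans (Fin.toℕ<n k) (m≤m+n s (suc mx))))

  NoneAbove : ℕ → Vec Letter L → Set
  NoneAbove mx w = ∀ y → mid Fin.< y → ¬ HatFixed mx w y

  noneAbove-∷ : ∀ {mx x} {w : Vec Letter L} → ¬ (mid Fin.< x) → NoneAbove (mx ▹ x) w ⇔ NoneAbove mx (x ∷ w)
  noneAbove-∷ x≯ = mk⇔
    (λ none y y> → λ { (inj₁ (refl , _)) → x≯ y> ; (inj₂ fix) → none y y> fix })
    (λ none y y> fix → none y y> (inj₂ fix))

  -- `A` and `B` are the conditions on tail and word apart from the order, so that one lemma serves
  -- `rest` and `start`.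
  expect-indicator : ∀ r {k} {w : Vec Letter L} {A B : Set} {f : ℕ → ℕ} → Unread r (small k ∷ w) → A ⇔ B →
    (∀ {r′} → Unread r′ w → Indicator (A × Ordered mid w) (f r′)) →
    Indicator (B × Ordered mid (small k ∷ w)) (expect r f k)
  expect-indicator zero    u e ih = ⊥-elim (unread-small-zero u)
  expect-indicator (suc r) {k} {w} {A} {B} u e ih = indicator-⇔ (mk⇔ join split)
    (indicator-×-dep (ind-indicator (toℕ k + suc r ℕ.≟ s)) λ eq → ih (unread-small eq u))
    where
    join : toℕ k + suc r ≡ s × A × Ordered mid w → B × Ordered mid (small k ∷ w)
    join (eq , a , ordered) = to e a , from (ordered-small u) (eq , ordered)
    split : B × Ordered mid (small k ∷ w) → toℕ k + suc r ≡ s × A × Ordered mid w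
    split (b , ordered) = let eq , ordered′ = to (ordered-small u) ordered in eq , from e b , ordered′

  unique-∷⁻ : ∀ {x} {w : Vec Letter L} → Unique (x ∷ w) → x ∉ w
  unique-∷⁻ (x∉w ∷ _) = All-≢⇒∉ x∉w

  -- p tells whether the letter before w is a record.
  Rest : Bool → ℕ → Vec Letter L → Set
  Rest p mx w = ((p ≡ true → closed? mx w ≡ false) × NoneAbove mx w) × Ordered mid w

  rest-indicator : ∀ r p mx (w : Vec Letter L) → Unread r w → mid ∉ w →
                   Indicator (Rest p (s + suc mx) w) (rest r p mx w)
  rest-indicator r true  mx [] u mid∉ = zero λ ((closed , _) , _) → case closed refl of λ ()
  rest-indicator r false mx [] u mid∉ rewrite unread-[] u = one (((λ ()) , λ _ _ ()) , [])
  rest-indicator r p mx (x ∷ w) u mid∉ with view x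
  ... | isMid     = ⊥-elim (mid∉ (here refl))
  ... | isSmall k = subst (Indicator _) (sym (classify-small k)) (expect-indicator r u
    (mk⇔ (λ (_ , none) → (λ _ → record?-small mx k) ,
            to (noneAbove-∷ (<-asym (small<mid k))) (subst (λ m → NoneAbove m w) (sym (▹-small mx k)) none))
         (λ (_ , none) → (λ ()) ,
            subst (λ m → NoneAbove m w) (▹-small mx k) (from (noneAbove-∷ (<-asym (small<mid k))) none)))
    (λ u′ → rest-indicator _ false mx w u′ (mid∉ ∘ there)))
  ... | isBig b = subst (Indicator _) (sym (classify-big b)) (indicator-⇔ (mk⇔ join split)
    (indicator-× (permits-indicator p (record? mx b))
      (rest-indicator r (record? mx b) (mx ▹ b) w (unread-skip (λ _ → small≢big) u) (mid∉ ∘ there))))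
    where
    join : (p ≡ true → record? mx b ≡ false) × Rest (record? mx b) (s + suc (mx ▹ b)) w →
           Rest p (s + suc mx) (big b ∷ w)
    join (permit , (¬closed , none) , ordered) =
      ((λ p≡ → trans (record?-big mx b) (permit p≡)) , none′) , ordered-skip (<-asym (mid<big b)) ordered
      where
      none′ : NoneAbove (s + suc mx) (big b ∷ w)
      none′ y y> fix rewrite record?-big mx b | ▹-big mx b with fix
      -- A closed record `big b` would be a fixed point above `mid`; the flag passed on by `b`
      -- excludes it.
      ... | inj₁ (_ , rec , cl) = case trans (sym cl) (¬closed rec) of λ ()
      ... | inj₂ fix′           = none y y> fix′
    split : Rest p (s + suc mx) (big b ∷ w) →
            (p ≡ true → record? mx b ≡ false) × Rest (record? mx b) (s + suc (mx ▹ b)) w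
    split ((permit , none) , _ ∷ ordered) rewrite record?-big mx b | ▹-big mx b =
      permit , ((λ rec → Bool.¬-not λ cl → none (big b) (mid<big b) (inj₁ (refl , rec , cl))) ,
                λ y y> fix → none y y> (inj₂ fix)) , ordered

  -- `TopFixed mid` for a suffix under an arbitrary bound, bracketed to fit `expect-indicator`.
  Top : ℕ → Vec Letter L → Set
  Top mx w = (HatFixed mx w mid × NoneAbove mx w) × Ordered mid w

  afterMid-indicator : ∀ r (w : Vec Letter L) → Unread r w → mid ∉ w →
    Indicator (closed? (s + 1) w ≡ true × NoneAbove (s + 1) w × Ordered mid w) (afterMid r w)
  afterMid-indicator r [] u mid∉ rewrite unread-[] u = one (refl , (λ _ _ ()) , [])
  afterMid-indicator r (x ∷ w) u mid∉ with view x
  ... | isMid     = ⊥-elim (mid∉ (here refl))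
  ... | isSmall k = subst (Indicator _) (sym (classify-small k))
    (zero λ (cl , _) → case trans (sym cl) (record?-small 0 k) of λ ())
  -- On a big letter `afterMid` agrees with `rest r false 0`, so `rest-indicator` applies.
  ... | isBig b = subst (Indicator _) (trans (classify-big b) (trans (*-identityˡ _) (sym (classify-big b))))
    (indicator-⇔ (mk⇔ (λ ((_ , none) , ordered) → record?-big 0 b , none , ordered)
                      (λ (_ , none , ordered) → ((λ ()) , none) , ordered))
                 (rest-indicator r false 0 (big b ∷ w) u mid∉))

  -- `mx ≤ s` expresses that only small letters precede, so `mid` is a record when it comes.
  start-indicator : ∀ r mx (w : Vec Letter L) → mx ≤ s → Unread r w → Indicator (Top mx w) (start r w)
  start-indicator r mx [] mx≤s u = zero λ ()
  start-indicator r mx (x ∷ w) mx≤s u with view x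
  ... | isSmall k = subst (Indicator _) (sym (classify-small k)) (expect-indicator r u
    (mk⇔ (λ (fix , none) → inj₂ fix , to (noneAbove-∷ (<-asym (small<mid k))) none)
         (λ { (inj₁ (e , _) , none) → ⊥-elim (small≢mid (sym e))
            ; (inj₂ fix , none) → fix , from (noneAbove-∷ (<-asym (small<mid k))) none }))
    (λ u′ → start-indicator _ (mx ▹ small k) w
      (⊔-lub mx≤s (subst (_≤ s) (cong suc (sym (toℕ-small k))) (Fin.toℕ<n k))) u′))
  ... | isBig b = subst (Indicator _) (sym (classify-big b)) (zero λ
    { ((inj₁ (e , _) , _) , _) → mid≢big e
    ; ((inj₂ fix , _) , _) → <⇒≱ (mid<big b)
        (≤-trans (n≤1+n _) (≤-trans (m≤n⊔m mx (suc (toℕ (big b)))) (hatFixed⇒≤ (mx ▹ big b) w fix))) })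
  ... | isMid = subst (Indicator _) (sym classify-mid) (indicator-⇔ (mk⇔ join split)
    (afterMid-indicator r w (unread-skip (λ _ → small≢mid) u) (unique-∷⁻ (u .unique))))
    where
    mid-record : record? mx mid ≡ true
    mid-record = from (record?⇔≤ {mx = mx}) (subst (mx ≤_) (sym toℕ-mid) mx≤s)
    mx▹mid : mx ▹ mid ≡ s + 1
    mx▹mid rewrite toℕ-mid | +-comm s 1 = m≤n⇒m⊔n≡n (m≤n⇒m≤1+n mx≤s)
    join : closed? (s + 1) w ≡ true × NoneAbove (s + 1) w × Ordered mid w → Top mx (mid ∷ w)
    join (cl , none , ordered) =
      (inj₁ (refl , mid-record , subst (λ m → closed? m w ≡ true) (sym mx▹mid) cl) ,
       to (noneAbove-∷ (<-irrefl refl)) (subst (λ m → NoneAbove m w) (sym mx▹mid) none)) ,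
      ordered-skip (<-irrefl refl) ordered
    split : Top mx (mid ∷ w) → closed? (s + 1) w ≡ true × NoneAbove (s + 1) w × Ordered mid w
    split ((inj₁ (_ , _ , cl) , none) , _ ∷ ordered) =
      subst (λ m → closed? m w ≡ true) mx▹mid cl ,
      subst (λ m → NoneAbove m w) mx▹mid (from (noneAbove-∷ (<-irrefl refl)) none) , ordered
    split ((inj₂ fix , _) , _) =
      ⊥-elim (<⇒≱ (m≤n⊔m mx (suc (toℕ mid))) (hatFixed⇒≤ (mx ▹ mid) w fix))

  ∑perms-topFixed-mid : ∑perms (s + suc N) (λ w → ind (topFixed? mid w)) ≡
                        ∑perms N (λ u → (s + hatNonfixed 0 u) C N)
  ∑perms-topFixed-mid = trans
    (∑perms-cong (s + suc N) λ w uw → indicator-unique (ind-indicator (topFixed? mid w))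
      (indicator-⇔ (mk⇔ (λ ((fix , none) , ordered) → fix , none , ordered)
                        (λ (fix , none , ordered) → (fix , none) , ordered))
        (start-indicator s 0 w z≤n record
          { r≤s    = ≤-refl
          ; unique = uw
          ; smalls = λ k → mk⇔ (λ _ → m≤n+m s (toℕ k)) (λ _ → unique-complete uw (small k))
          })))
    ∑perms-start

-- Assembling the formula

∑perms-topFixed : ∀ {n} (c : Fin n) → ∑perms n (λ w → ind (topFixed? c w)) ≡
  ∑perms (n ∸ suc (toℕ c)) (λ u → (toℕ c + hatNonfixed 0 u) C (n ∸ suc (toℕ c)))
∑perms-topFixed {n} c = at-mid c (sym (trans (+-suc (toℕ c) _) (m+[n∸m]≡n (Fin.toℕ<n c)))) refl
  where
  -- With `n` a variable the equations can be matched, turning `n` into `s + suc N` and `c` into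
  -- `mid`.
  at-mid : ∀ {n s N} (c : Fin n) → n ≡ s + suc N → toℕ c ≡ s →
    ∑perms n (λ w → ind (topFixed? c w)) ≡ ∑perms N (λ u → (s + hatNonfixed 0 u) C N)
  at-mid {s = s} {N} c refl c≡s
    rewrite Fin.toℕ-injective {i = c} {j = Automaton.mid s N} (trans c≡s (sym (Automaton.toℕ-mid s N)))
    = ∑perms-topFixed-mid s N

sumₗ-applyUpTo : ∀ (f g : ℕ → ℕ) n → sumₗ (List.map f (List.applyUpTo g n)) ≡ sum {n} (λ i → f (g (toℕ i)))
sumₗ-applyUpTo f g zero    = refl
sumₗ-applyUpTo f g (suc n) = cong (f (g 0) +_) (sumₗ-applyUpTo f (g ∘ suc) n)

theorem3p2 : (n : ℕ) → 1 ≤ n →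
    ∣𝒮 n [ ⟨21⨾3→3⟩ ]∣ ≡
    derangements n +
    ∑[ 1 ⋯ n ] (λ m → ∑[ 0 ⋯ n ∸ m ] (λ k →
    ((n ∸ m) C k) * ((m + k ∸ 1) C (n ∸ m)) * derangements k))
theorem3p2 n _ = begin
  ∣𝒮 n [ ⟨21⨾3→3⟩ ]∣
    ≡⟨ countPermutations-∑words (avoids? {n = n} ⟨21⨾3→3⟩) ⟩
  ∑perms n (λ π → ind (avoids? ⟨21⨾3→3⟩ π))
    ≡⟨ ∑perms-cong n (λ π uπ → indicator-unique (ind-indicator (avoids? ⟨21⨾3→3⟩ π)) (split π uπ)) ⟩
  ∑perms n (λ π → δ (hatNonfixed 0 π) n + sum λ c → ind (topFixed? c π))
    ≡⟨ ∑perms-+ n (λ π → δ (hatNonfixed 0 π) n) _ ⟩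
  ∑perms n (λ π → δ (hatNonfixed 0 π) n) + ∑perms n (λ π → sum λ c → ind (topFixed? c π))
    ≡⟨ cong₂ _+_ no-fixed (∑perms-sum {n} n λ c π → ind (topFixed? c π)) ⟩
  derangements n + sum (λ c → ∑perms n λ π → ind (topFixed? c π))
    ≡⟨ cong (derangements n +_) (sum-cong-≗ {n} top) ⟩
  derangements n + sum {n} (λ c → inner (suc (toℕ c)))
    ≡⟨ cong (derangements n +_) (sumₗ-applyUpTo inner suc n) ⟨
  derangements n + ∑[ 1 ⋯ n ] inner ∎
  where
  open ≡-Reasoning
  term : ℕ → ℕ → ℕ
  term m k = ((n ∸ m) C k) * ((m + k ∸ 1) C (n ∸ m)) * derangements k
  inner : ℕ → ℕ
  inner m = ∑[ 0 ⋯ n ∸ m ] (term m)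
  split : ∀ π → Unique π → Indicator (Avoids ⟨21⨾3→3⟩ π)
            (δ (hatNonfixed 0 π) n + sum λ c → ind (topFixed? c π))
  split π uπ = indicator-⇔ (avoids⇔ uπ) (indicator-⊎
    (λ (none , c , fix , _) → none c fix)
    (indicator-⇔ (mk⇔ (from (hatNonfixed≡length 0 π)) (to (hatNonfixed≡length 0 π)))
                 (ind-indicator (hatNonfixed 0 π ℕ.≟ n)))
    (indicator-∃ topFixed-unique λ c → ind-indicator (topFixed? c π)))
  no-fixed : ∑perms n (λ π → δ (hatNonfixed 0 π) n) ≡ derangements n
  no-fixed = trans (distribution hatNonfixed-statistic n n)
    (trans (cong (_* ! n) (nCn≡1 n)) (trans (*-identityˡ (! n)) (sym (derangements≡! n))))
  -- `c` counts from 0: with `m = suc (toℕ c)`, `m + k ∸ 1` reduces to `toℕ c + k`.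
  top : ∀ c → ∑perms n (λ π → ind (topFixed? c π)) ≡ inner (suc (toℕ c))
  top c = begin
    ∑perms n (λ π → ind (topFixed? c π))
      ≡⟨ ∑perms-topFixed c ⟩
    ∑perms N (λ u → (toℕ c + hatNonfixed 0 u) C N)
      ≡⟨ ∑perms-statistic hatNonfixed-statistic N (hatNonfixed≤ 0) (λ g → (toℕ c + g) C N) ⟩
    sum {suc N} (λ k → (N C toℕ k) * ((toℕ c + toℕ k) C N) * ! toℕ k)
      ≡⟨ sum-cong-≗ {suc N} (λ k →
           cong ((N C toℕ k) * ((toℕ c + toℕ k) C N) *_) (sym (derangements≡! (toℕ k)))) ⟩
    sum {suc N} (λ k → term (suc (toℕ c)) (toℕ k))
      ≡⟨ sumₗ-applyUpTo (term (suc (toℕ c))) (λ k → k) (suc N) ⟨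
    inner (suc (toℕ c)) ∎
    where N = n ∸ suc (toℕ c)
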